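{- Let $\Pi=\langle\mathcal{S},\mathcal{M}\rangle$ be a coherent modular program, let $\vec{p}=\mathit{int}(\Pi)$, and let $\vec{h}=\mathit{pred}(\Phi(\Pi))\setminus\mathcal{S}$. Then (i) an interpretation $\mathcal{I}$ is a model of $\Pi$ if and only if $\mathcal{I}$ is a model of $\exists\vec{h}\,\mathrm{SM}_{\vec{p}}[\mathcal{F}(\Pi)]$; and (ii) a Herbrand interpretation $\mathcal{I}$ is an answer set of $\Pi$ if and only if there is an answer set $\mathcal{J}$ of $\mathcal{F}(\Pi)$ such that $\mathcal{I}=\mathcal{J}|_{\mathcal{S}}$.
   Context: $\mathrm{SM}_{\vec{p}}[F]:=F\wedge\neg\exists\vec{U}((\vec{U}<\vec{p})\wedge F^*)$ with fresh predicate variables $\vec{U}$, where $\vec{U}<\vec{p}$ means $\bigwedge_i\forall\vec{x}(U_i(\vec{x})\to p_i(\vec{x}))\wedge\neg\bigwedge_i\forall\vec{x}(p_i(\vec{x})\to U_i(\vec{x}))$, and $F^*$: $F^*=F$ for atomic $F$ without members of $\vec{p}$; $p_i(\vec{t})^*=U_i(\vec{t})$; $(G\otimes H)^*=G^*\otimes H^*$ for $\otimes\in\{\wedge,\vee\}$; $(G\to H)^*=(G^*\to H^*)\wedge(G\to H)$; $(Qx\,G)^*=Qx\,G^*$. $\exists\vec{h}\,\mathrm{SM}_{\vec{p}}[F]$ means $\exists\vec{H}\,\mathrm{SM}_{\vec{p}}[F^{\vec{h}}_{\vec{H}}]$, with the symbols of $\vec{h}$ replaced by fresh predicate variables $\vec{H}$.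 $\mathit{pred}(F)$: free predicate symbols of $F$ other than equality. An answer set of a formula $F$ is a Herbrand model of $\mathrm{SM}_{\mathit{pred}(F)}[F]$; $\mathcal{J}|_{\mathcal{S}}$ is the restriction to the predicates in $\mathcal{S}$. A def-module is $(\vec{p}:F)$ with $\Phi((\vec{p}:F))=\mathrm{SM}_{\vec{p}}[F]$. A modular program $\Pi=\langle\mathcal{S},\mathcal{M}\rangle$: $\mathcal{S}$ public predicates, $\mathcal{M}$ a finite set of def-modules or modular programs; $\Phi(\Pi)=\exists\vec{h}\bigwedge_{M\in\mathcal{M}}\Phi(M)$, $\vec{h}$ the free predicate symbols of the $\Phi(M)$ not in $\mathcal{S}$. A model of $\Pi$ is a model of $\Phi(\Pi)$; an answer set of $\Pi$ is a Herbrand interpretation over $\mathcal{S}$ that is a model of $\Pi$. $\mathit{defmods}(\Pi)$: all def-modules occurring in $\Pi$ at any level. $\mathit{int}(\Pi)=\bigcup\{\vec{p}\mid(\vec{p}:F)\in\mathit{defmods}(\Pi)\}$; $\mathcal{F}(\Pi)=\bigwedge\{F\mid(\vec{p}:F)\in\mathit{defmods}(\Pi)\}$. A rule is a sentence $\widetilde{\forall}(a_{k+1}\wedge\dots\wedge a_l\wedge\neg a_{l+1}\wedge\dots\wedge\neg a_m\wedge\neg\neg a_{m+1}\wedge\dots\wedge\neg\neg a_n\to a_1\vee\dots\vee a_k)$ with atoms $a_i$ ($\widetilde{\forall}$ the universal closure); $a_1\vee\dots\vee a_k$ is its head and $a_{k+1},\dots,a_l$ its positive body. $\Pi$ is simple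 if for every $(\vec{p}:F)\in\mathit{defmods}(\Pi)$, $F$ is a conjunction of rules whose head predicate symbols all belong to $\vec{p}$. The dependency graph $DG[\Pi]$ has vertex set $\mathit{int}(\Pi)$ and an edge $(p,q)$ whenever some rule in $\Pi$ has $p$ in its head and $q$ in its positive body. $\Pi$ is in $\alpha$-normal form if for every predicate name, either all its occurrences in $\Phi(\Pi)$ are free or all are bound by the same single occurrence of an existential quantifier. $\Pi$ is coherent if it is simple, in $\alpha$-normal form, any two distinct def-modules $(\vec{p}:F),(\vec{p}':F')\in\mathit{defmods}(\Pi)$ satisfy $\vec{p}\cap\vec{p}'=\emptyset$, and for every strongly connected component of $DG[\Pi]$ there is a def-module $(\vec{p}:F)\in\mathit{defmods}(\Pi)$ with $\vec{p}$ containing all vertices of that component.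
   Formalization: Needed additions: no public name of Π is bound by a quantifier in Φ(Π); in (ii), int(Π) = pred(F(Π)). In h, pred(Φ(Π)) is read as all predicate symbols occurring in Φ(Π), free or bound, since the free ones outside S are none. -}

module Defs where

open import Level using (0ℓ)
open import Data.Bool using (Bool; true; false; T; if_then_else_) renaming (_∧_ to _&&_)
import Data.Bool.Properties as Bool
open import Data.Empty using (⊥)
open import Data.Fin using (Fin)
open import Data.List using (List; []; _∷_; _++_; map; foldr; filter; concatMap; deduplicate)
open import Data.List.Membership.Propositional using (_∈_)
open import Data.List.Relation.Binary.Disjoint.Propositional using (Disjoint)
open import Data.List.Relation.Unary.All using (All)
open import Data.Maybe using (Maybe; just; nothing)
open import Data.Nat using (ℕ; zero; suc)
open import Data.Product using (_×_; ∃; ∃-syntax)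
open import Data.Sum using (_⊎_)
open import Data.Vec using (Vec; []; _∷_; tabulate; lookup)
open import Function using (_⇔_)
open import Relation.Binary using (Rel; DecidableEquality)
open import Relation.Binary.Construct.Closure.ReflexiveTransitive using (Star)
open import Relation.Binary.PropositionalEquality using (_≡_; _≢_; refl; cong)
open import Relation.Nullary using (Dec; yes; no; ¬_; ¬?; does)
open import Relation.Nullary.Decidable using (map′)
open import Relation.Unary using (Pred; _⊆_)

record Signature : Set₁ where
  field
    Fn  : Set
    Pr  : Set
    arᶠ : Fn → ℕ
    arᵖ : Pr → ℕ
    _≟_ : DecidableEquality Pr

module Language (Sg : Signature) where
  open Signature Sg

  -- Object variables are de Bruijn indices: in `Term n`, `Formula n` and
  -- `SOFormula n` at most n object variables are free.

  data Term (n : ℕ) : Set where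
    var : Fin n → Term n
    fun : (f : Fn) → Vec (Term n) (arᶠ f) → Term n

  data Atom (n : ℕ) : Set where
    rel : (q : Pr) → Vec (Term n) (arᵖ q) → Atom n
    _≐_ : Term n → Term n → Atom n

  infixr 7 _∧_
  infixr 6 _∨_
  infixr 5 _⇒_

  data Formula (n : ℕ) : Set where
    atom        : Atom n → Formula n
    ⊥′          : Formula n
    _∧_ _∨_ _⇒_ : Formula n → Formula n → Formula n
    ∀′ ∃′       : Formula (suc n) → Formula n

  -- `sym q` is the predicate symbol q.  `fresh q` is the predicate variable U
  -- that SM pairs with q; it is fresh because first-order formulas cannot
  -- mention it and SM is only ever applied to first-order formulas.
  data PName : Set where
    sym fresh : Pr → PName

  arity : PName → ℕ
  arity (sym q)   = arᵖ q
  arity (fresh q) = arᵖ q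

  -- ∃ᵖ x G binds the name x itself.  When x = sym h this is the formula ∃H G′,
  -- where G′ replaces h by a new variable H, up to renaming of the bound
  -- variable.  Keeping the name is what makes α-normal form expressible.
  data SOFormula (n : ℕ) : Set where
    rel         : (x : PName) → Vec (Term n) (arity x) → SOFormula n
    _≐_         : Term n → Term n → SOFormula n
    ⊥′          : SOFormula n
    _∧_ _∨_ _⇒_ : SOFormula n → SOFormula n → SOFormula n
    ∀′ ∃′       : SOFormula (suc n) → SOFormula n
    ∃ᵖ          : PName → SOFormula n → SOFormula n

  ¬′ : ∀ {n} → Formula n → Formula n
  ¬′ F = F ⇒ ⊥′

  ⋀ : ∀ {n} → List (Formula n) → Formula n
  ⋀ []           = ⊥′ ⇒ ⊥′
  ⋀ (F ∷ [])     = F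
  ⋀ (F ∷ G ∷ Fs) = F ∧ ⋀ (G ∷ Fs)

  ⋁ : ∀ {n} → List (Formula n) → Formula n
  ⋁ []           = ⊥′
  ⋁ (F ∷ [])     = F
  ⋁ (F ∷ G ∷ Fs) = F ∨ ⋁ (G ∷ Fs)

  ∀* : ∀ {n} → Formula n → Formula 0
  ∀* {zero}  F = F
  ∀* {suc n} F = ∀* (∀′ F)

  ¬² : ∀ {n} → SOFormula n → SOFormula n
  ¬² F = F ⇒ ⊥′

  ⋀² : ∀ {n} → List (SOFormula n) → SOFormula n
  ⋀² []           = ⊥′ ⇒ ⊥′
  ⋀² (F ∷ [])     = F
  ⋀² (F ∷ G ∷ Fs) = F ∧ ⋀² (G ∷ Fs)

  ∀*² : ∀ {n} → SOFormula n → SOFormula 0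
  ∀*² {zero}  F = F
  ∀*² {suc n} F = ∀*² (∀′ F)

  ∃ᵖ* : ∀ {n} → List PName → SOFormula n → SOFormula n
  ∃ᵖ* xs F = foldr ∃ᵖ F xs

  ⌈_⌉ : ∀ {n} → Formula n → SOFormula n
  ⌈ atom (rel q ts) ⌉ = rel (sym q) ts
  ⌈ atom (t ≐ u) ⌉    = t ≐ u
  ⌈ ⊥′ ⌉              = ⊥′
  ⌈ F ∧ G ⌉           = ⌈ F ⌉ ∧ ⌈ G ⌉
  ⌈ F ∨ G ⌉           = ⌈ F ⌉ ∨ ⌈ G ⌉
  ⌈ F ⇒ G ⌉           = ⌈ F ⌉ ⇒ ⌈ G ⌉
  ⌈ ∀′ F ⌉            = ∀′ ⌈ F ⌉
  ⌈ ∃′ F ⌉            = ∃′ ⌈ F ⌉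

  open import Data.List.Membership.DecPropositional _≟_ using (_∈?_)

  star : ∀ {n} → List Pr → Formula n → SOFormula n
  star p (atom (rel q ts)) with does (q ∈? p)
  ... | true  = rel (fresh q) ts
  ... | false = rel (sym q) ts
  star p (atom (t ≐ u)) = t ≐ u
  star p ⊥′             = ⊥′
  star p (F ∧ G)        = star p F ∧ star p G
  star p (F ∨ G)        = star p F ∨ star p G
  star p (F ⇒ G)        = (star p F ⇒ star p G) ∧ ⌈ F ⇒ G ⌉
  star p (∀′ F)         = ∀′ (star p F)
  star p (∃′ F)         = ∃′ (star p F)

  -- ∀x⃗ (x(x⃗) → y(x⃗)) for the two names attached to the predicate symbol q
  fresh⇒sym sym⇒fresh : Pr → SOFormula 0
  fresh⇒sym q = ∀*² (rel (fresh q) (tabulate var) ⇒ rel (sym q) (tabulate var))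
  sym⇒fresh q = ∀*² (rel (sym q) (tabulate var) ⇒ rel (fresh q) (tabulate var))

  U<_ : List Pr → SOFormula 0
  U< p = ⋀² (map fresh⇒sym p) ∧ ¬² (⋀² (map sym⇒fresh p))

  -- The list p stands for the tuple; a repeated entry changes nothing up to
  -- logical equivalence.
  SM : List Pr → Formula 0 → SOFormula 0
  SM p F = ⌈ F ⌉ ∧ ¬² (∃ᵖ* (map fresh p) (U< p ∧ star p F))

  record Interpretation : Set₁ where
    field
      Dom       : Set
      inhabited : Dom
      fnᴵ       : (f : Fn) → Vec Dom (arᶠ f) → Dom
      relᴵ      : (q : Pr) → Vec Dom (arᵖ q) → Bool

  _≟ᴾ_ : DecidableEquality PName
  sym p   ≟ᴾ sym q   = map′ (cong sym) (λ { refl → refl }) (p ≟ q)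
  sym p   ≟ᴾ fresh q = no λ ()
  fresh p ≟ᴾ sym q   = no λ ()
  fresh p ≟ᴾ fresh q = map′ (cong fresh) (λ { refl → refl }) (p ≟ q)

  module Semantics (I : Interpretation) where
    open Interpretation I

    mutual
      eval : ∀ {n} → Vec Dom n → Term n → Dom
      eval σ (var i)    = lookup σ i
      eval σ (fun f ts) = fnᴵ f (evals σ ts)

      evals : ∀ {n k} → Vec Dom n → Vec (Term n) k → Vec Dom k
      evals σ []       = []
      evals σ (t ∷ ts) = eval σ t ∷ evals σ ts

    Relation : ℕ → Set
    Relation k = Vec Dom k → Bool

    Valuation : Set
    Valuation = (x : PName) → Relation (arity x)

    _[_↦_] : Valuation → (x : PName) → Relation (arity x) → Valuation
    (ρ [ x ↦ R ]) y with x ≟ᴾ y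
    ... | yes refl = R
    ... | no _     = ρ y

    Sat : ∀ {n} → Valuation → Vec Dom n → SOFormula n → Set
    Sat ρ σ (rel x ts) = T (ρ x (evals σ ts))
    Sat ρ σ (t ≐ u)    = eval σ t ≡ eval σ u
    Sat ρ σ ⊥′         = ⊥
    Sat ρ σ (F ∧ G)    = Sat ρ σ F × Sat ρ σ G
    Sat ρ σ (F ∨ G)    = Sat ρ σ F ⊎ Sat ρ σ G
    Sat ρ σ (F ⇒ G)    = Sat ρ σ F → Sat ρ σ G
    Sat ρ σ (∀′ F)     = (d : Dom) → Sat ρ (d ∷ σ) F
    Sat ρ σ (∃′ F)     = ∃[ d ] Sat ρ (d ∷ σ) F
    Sat ρ σ (∃ᵖ x F)   = ∃[ R ] Sat (ρ [ x ↦ R ]) σ F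

    -- The value on `fresh q` is irrelevant: it is only used for sentences
    -- in which every `fresh q` is bound.
    valuation : Valuation
    valuation (sym q)   = relᴵ q
    valuation (fresh q) = λ _ → false

  infix 3 _⊨_
  _⊨_ : Interpretation → SOFormula 0 → Set
  I ⊨ F = Sat valuation [] F
    where open Semantics I

  -- A set of predicate symbols, possibly infinite, as a characteristic function.
  PrSet : Set
  PrSet = Pr → Bool

  atomPred : ∀ {n} → Atom n → List Pr
  atomPred (rel q _) = q ∷ []
  atomPred (_ ≐ _)   = []

  pred : ∀ {n} → Formula n → List Pr
  pred (atom a) = atomPred a
  pred ⊥′       = []
  pred (F ∧ G)  = pred F ++ pred G
  pred (F ∨ G)  = pred F ++ pred G
  pred (F ⇒ G)  = pred F ++ pred G
  pred (∀′ F)   = pred F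
  pred (∃′ F)   = pred F

  freePreds : ∀ {n} → SOFormula n → List Pr
  freePreds (rel (sym q) _)    = q ∷ []
  freePreds (rel (fresh _) _)  = []
  freePreds (_ ≐ _)            = []
  freePreds ⊥′                 = []
  freePreds (F ∧ G)            = freePreds F ++ freePreds G
  freePreds (F ∨ G)            = freePreds F ++ freePreds G
  freePreds (F ⇒ G)            = freePreds F ++ freePreds G
  freePreds (∀′ F)             = freePreds F
  freePreds (∃′ F)             = freePreds F
  freePreds (∃ᵖ (sym q) F)     = filter (λ r → ¬? (q ≟ r)) (freePreds F)
  freePreds (∃ᵖ (fresh _) F)   = freePreds F

  -- All predicate symbols with an occurrence, whether free or bound.
  allPreds : ∀ {n} → SOFormula n → List Pr
  allPreds (rel (sym q) _)   = q ∷ []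
  allPreds (rel (fresh _) _) = []
  allPreds (_ ≐ _)           = []
  allPreds ⊥′                = []
  allPreds (F ∧ G)           = allPreds F ++ allPreds G
  allPreds (F ∨ G)           = allPreds F ++ allPreds G
  allPreds (F ⇒ G)           = allPreds F ++ allPreds G
  allPreds (∀′ F)            = allPreds F
  allPreds (∃′ F)            = allPreds F
  allPreds (∃ᵖ _ F)          = allPreds F

  _∖_ : List Pr → PrSet → List Pr
  qs ∖ S = deduplicate _≟_ (filter (λ q → S q Bool.≟ false) qs)

  record DefModule : Set where
    constructor _∶_
    field
      intensional : List Pr
      formula     : Formula 0
  open DefModule public

  -- The finite set of submodules is given by a list; conjunction makes order
  -- and repetition immaterial up to logical equivalence.
  mutual
    data Module : Set where
      defModule  : DefModule → Module
      subProgram : ModularProgram → Module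

    data ModularProgram : Set where
      ⟨_,_⟩ : PrSet → List Module → ModularProgram

  public′ : ModularProgram → PrSet
  public′ ⟨ S , _ ⟩ = S

  mutual
    Φ : ModularProgram → SOFormula 0
    Φ ⟨ S , Ms ⟩ = ∃ᵖ* (map sym (freePreds (⋀² (Φs Ms)) ∖ S)) (⋀² (Φs Ms))

    Φᴹ : Module → SOFormula 0
    Φᴹ (defModule (p ∶ F)) = SM p F
    Φᴹ (subProgram Π)      = Φ Π

    Φs : List Module → List (SOFormula 0)
    Φs []       = []
    Φs (M ∷ Ms) = Φᴹ M ∷ Φs Ms

  mutual
    defmods : ModularProgram → List DefModule
    defmods ⟨ _ , Ms ⟩ = defmodsList Ms

    defmodsList : List Module → List DefModule
    defmodsList []                  = []
    defmodsList (defModule d ∷ Ms)  = d ∷ defmodsList Ms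
    defmodsList (subProgram Π ∷ Ms) = defmods Π ++ defmodsList Ms

  int : ModularProgram → List Pr
  int Π = concatMap intensional (defmods Π)

  𝓕 : ModularProgram → Formula 0
  𝓕 Π = ⋀ (map formula (defmods Π))

  record Rule : Set where
    field
      vars              : ℕ
      head pos neg nneg : List (Atom vars)

  ruleFormula : Rule → Formula 0
  ruleFormula r =
    ∀* (⋀ (map atom pos ++ map (λ a → ¬′ (atom a)) neg ++ map (λ a → ¬′ (¬′ (atom a))) nneg)
        ⇒ ⋁ (map atom head))
    where open Rule r

  headPreds posPreds : Rule → List Pr
  headPreds r = concatMap atomPred (Rule.head r)
  posPreds  r = concatMap atomPred (Rule.pos r)

  -- Any bracketing is allowed, and so is the empty conjunction.
  data ConjunctionOfRules (P : Pred Rule 0ℓ) : Formula 0 → Set where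
    empty : ConjunctionOfRules P (⋀ [])
    rule  : (r : Rule) → P r → ConjunctionOfRules P (ruleFormula r)
    _∧_   : ∀ {F G} → ConjunctionOfRules P F → ConjunctionOfRules P G →
            ConjunctionOfRules P (F ∧ G)

  data RuleIn (r : Rule) : Formula 0 → Set where
    here  : RuleIn r (ruleFormula r)
    left  : ∀ {F G} → RuleIn r F → RuleIn r (F ∧ G)
    right : ∀ {F G} → RuleIn r G → RuleIn r (F ∧ G)

  Simple : ModularProgram → Set
  Simple Π = ∀ {d} → d ∈ defmods Π →
    ConjunctionOfRules (λ r → ∀ {q} → q ∈ headPreds r → q ∈ intensional d) (formula d)

  record Edge (Π : ModularProgram) (p q : Pr) : Set where
    field
      source∈  : p ∈ int Π
      target∈  : q ∈ int Π
      {d}      : DefModule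
      d∈       : d ∈ defmods Π
      {r}      : Rule
      r∈       : RuleIn r (formula d)
      p∈head   : p ∈ headPreds r
      q∈body   : q ∈ posPreds r

  Path : ModularProgram → Rel Pr 0ℓ
  Path Π = Star (Edge Π)

  record StronglyConnected (Π : ModularProgram) (C : Pred Pr 0ℓ) : Set where
    field
      nonempty  : ∃ C
      vertices  : ∀ {q} → C q → q ∈ int Π
      connected : ∀ {p q} → C p → C q → Path Π p q

  record SCC (Π : ModularProgram) (C : Pred Pr 0ℓ) : Set₁ where
    field
      stronglyConnected : StronglyConnected Π C
      maximal           : (D : Pred Pr 0ℓ) → StronglyConnected Π D → C ⊆ D → D ⊆ C

  isSym : Pr → PName → Bool
  isSym q (sym r)   = does (q ≟ r)
  isSym q (fresh _) = false

  Position : Set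
  Position = List ℕ

  -- `binders q b π F` has one entry per occurrence of q in F, from left to
  -- right: the position of the quantifier binding it, or `nothing` if it is
  -- free.  Here F itself sits at position π, in a context where q is bound by b.
  binders : ∀ {n} → Pr → Maybe Position → Position → SOFormula n → List (Maybe Position)
  binders q b π (rel x _) = if isSym q x then b ∷ [] else []
  binders q b π (_ ≐ _)   = []
  binders q b π ⊥′        = []
  binders q b π (F ∧ G)   = binders q b (0 ∷ π) F ++ binders q b (1 ∷ π) G
  binders q b π (F ∨ G)   = binders q b (0 ∷ π) F ++ binders q b (1 ∷ π) G
  binders q b π (F ⇒ G)   = binders q b (0 ∷ π) F ++ binders q b (1 ∷ π) G
  binders q b π (∀′ F)    = binders q b (0 ∷ π) F
  binders q b π (∃′ F)    = binders q b (0 ∷ π) F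
  binders q b π (∃ᵖ x F)  = binders q (if isSym q x then just π else b) (0 ∷ π) F

  AllFree : Pr → SOFormula 0 → Set
  AllFree q F = All (_≡ nothing) (binders q nothing [] F)

  AllBoundByOne : Pr → SOFormula 0 → Set
  AllBoundByOne q F = ∃[ π ] All (_≡ just π) (binders q nothing [] F)

  AlphaNormal : ModularProgram → Set
  AlphaNormal Π = ∀ q → AllFree q (Φ Π) ⊎ AllBoundByOne q (Φ Π)

  record Coherent (Π : ModularProgram) : Set₁ where
    field
      simple      : Simple Π
      alphaNormal : AlphaNormal Π
      disjoint    : ∀ {d d′} → d ∈ defmods Π → d′ ∈ defmods Π → d ≢ d′ →
                    Disjoint (intensional d) (intensional d′)
      components  : (C : Pred Pr 0ℓ) → SCC Π C →
                    ∃[ d ] (d ∈ defmods Π × (∀ {q} → C q → q ∈ intensional d))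

  -- No quantifier of Φ(Π) captures a public name of Π.  α-normal form of Φ(Π)
  -- alone does not give this: a public name of Π may be hidden in a subprogram.
  PublicFree : ModularProgram → Set
  PublicFree Π = ∀ q → T (public′ Π q) → AllFree q (Φ Π)

  -- Free predicate symbols of Φ(Π) all belong to the public set, so the symbols
  -- outside it are found only among the bound ones.
  hidden : ModularProgram → List Pr
  hidden Π = allPreds (Φ Π) ∖ public′ Π

  -- A Herbrand interpretation is a set of ground atoms; it is an interpretation
  -- over S when all of these atoms have their predicate symbol in S.
  record Herbrand : Set where
    field
      inhabitedᴴ : Term 0
      relᴴ       : (q : Pr) → Vec (Term 0) (arᵖ q) → Bool
  open Herbrand public

  ⟦_⟧ᴴ : Herbrand → Interpretation
  ⟦ I ⟧ᴴ = record { Dom = Term 0 ; inhabited = inhabitedᴴ I ; fnᴵ = fun ; relᴵ = relᴴ I }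

  _over_ : Herbrand → PrSet → Set
  I over S = ∀ q ts → T (relᴴ I q ts) → T (S q)

  _∣_ : Herbrand → PrSet → Herbrand
  J ∣ S = record { inhabitedᴴ = inhabitedᴴ J ; relᴴ = λ q ts → S q && relᴴ J q ts }

  _≈ᴴ_ : Herbrand → Herbrand → Set
  I ≈ᴴ J = ∀ q ts → relᴴ I q ts ≡ relᴴ J q ts

  AnswerSetOfFormula : Formula 0 → Herbrand → Set
  AnswerSetOfFormula F J = ⟦ J ⟧ᴴ ⊨ SM (pred F) F

  AnswerSetOfProgram : ModularProgram → Herbrand → Set
  AnswerSetOfProgram Π I = I over public′ Π × (⟦ I ⟧ᴴ ⊨ Φ Π)

  _≈ˢ_ : List Pr → List Pr → Set
  p ≈ˢ p′ = ∀ q → q ∈ p ⇔ q ∈ p′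

{-# OPTIONS --safe #-}
module Submission where

-- SM p F holds at M iff M is p-stable: M satisfies F classically, and no
-- W ⊑ M that differs from M, and only on p, satisfies F in the logic of
-- here-and-there together with M.
--
-- Splitting.  If W refutes stability for int(Π), take among the predicates on
-- which W differs from M one from which no other component of the dependency
-- graph with such predicates is reachable.  Undoing the change outside its
-- component still satisfies every rule of the def-module containing that
-- component, so that module is not stable either.  Conversely, changing only
-- predicates of one def-module cannot falsify the rules of another one, since
-- their heads are kept.
--
-- Hiding.  In α-normal form, a predicate symbol shared by two conjuncts is free
-- in both, so the witnesses of all second-order quantifiers of Φ(Π) can be
-- merged into one interpretation.

open import Defs
open import Level using (0ℓ)
open import Axiom.ExcludedMiddle using (ExcludedMiddle)
open import Data.List using (List; []; _∷_; _++_; map; concatMap)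
open import Data.Product using (_×_; ∃-syntax)
open import Function using (_⇔_)

open import Data.Bool using (Bool; true; false; T; if_then_else_) renaming (_∧_ to _&&_)
import Data.Bool.Properties as Bool
open import Data.Empty using (⊥; ⊥-elim)
open import Data.Fin using (Fin; zero; suc)
open import Data.List.Membership.Propositional using (_∈_; _∉_; find; lose)
open import Data.List.Membership.Propositional.Properties
  using (∈-++⁺ˡ; ∈-++⁺ʳ; ∈-++⁻; ∈-map⁺; ∈-map⁻; ∈-filter⁺; ∈-filter⁻;
         ∈-deduplicate⁺; ∈-deduplicate⁻; ∈-concat⁺′; ∈-concat⁻′)
open import Data.List.Properties using (++-identityʳ; ++-cancelʳ; ++-identityˡ-unique; ∷ʳ-++; ∷ʳ-injectiveʳ)
open import Data.List.Relation.Unary.All using (All; []; _∷_)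
import Data.List.Relation.Unary.All as All
import Data.List.Relation.Unary.All.Properties as All
open import Data.List.Relation.Unary.Any using (Any; here; there)
import Data.List.Relation.Unary.Any as Any
import Data.List.Relation.Unary.Any.Properties as Any
open import Data.Maybe using (Maybe; just; nothing)
open import Data.Maybe.Properties using (just-injective)
open import Data.Nat using (zero; suc)
open import Data.Product using (_,_; proj₁; proj₂; ∃)
open import Data.Product.Function.NonDependent.Propositional using (_×-⇔_)
open import Data.Sum using (_⊎_; inj₁; inj₂; [_,_]′)
open import Data.Sum.Function.Propositional using (_⊎-⇔_)
open import Data.Vec using (Vec; []; _∷_; tabulate; lookup)
open import Data.Vec.Properties using (tabulate∘lookup)
open import Function using (mk⇔; Equivalence; _∘_; id)
open import Function.Construct.Composition using (_⇔-∘_)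
open import Function.Construct.Identity using (⇔-id)
open import Function.Construct.Symmetry using (⇔-sym)
open import Function.Related.TypeIsomorphisms using (→-cong-⇔)
open import Relation.Binary using (Rel; Transitive)
open import Relation.Binary.Construct.Closure.ReflexiveTransitive using (ε; _◅_; _◅◅_)
open import Relation.Binary.PropositionalEquality as ≡ using (_≡_; _≢_; _≗_; refl; cong; cong₂; subst)
open import Relation.Nullary using (yes; no; ¬_; does)
open import Relation.Nullary.Decidable using (T?; decidable-stable; dec-true; dec-false)
open import Relation.Unary using (Pred; Decidable)

open Equivalence using (to; from)

-- Equivalences between types and between Boolean truth values.

∀-⇔ : {A : Set} {B C : A → Set} → (∀ a → B a ⇔ C a) → (∀ a → B a) ⇔ (∀ a → C a)
∀-⇔ eq = mk⇔ (λ f a → to (eq a) (f a)) (λ f a → from (eq a) (f a))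

∃-⇔ : {A : Set} {B C : A → Set} → (∀ a → B a ⇔ C a) → ∃ B ⇔ ∃ C
∃-⇔ eq = mk⇔ (λ (a , b) → a , to (eq a) b) (λ (a , c) → a , from (eq a) c)

T-cong : ∀ {a b} → a ≡ b → T a ⇔ T b
T-cong eq = mk⇔ (subst T eq) (subst T (≡.sym eq))

T-injective : ∀ {a b} → T a ⇔ T b → a ≡ b
T-injective {false} {false} _  = refl
T-injective {false} {true}  eq = ⊥-elim (from eq _)
T-injective {true}  {false} eq = ⊥-elim (to eq _)
T-injective {true}  {true}  _  = refl

-- Terminal elements of a finite list under a transitive relation.

module _ {A : Set} {_≲_ : Rel A 0ℓ} (em : ExcludedMiddle 0ℓ) (≲-trans : Transitive _≲_) where

  -- Induction on the list: the candidate `m` of the tail is kept unless `x` lies above it and not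
  -- below it. In that case `x` replaces `m`, and anything above `x` is above `m`, hence below `m`
  -- and so below `x`.
  sink : (P : Pred A 0ℓ) (xs : List A) {a : A} → a ∈ xs → P a →
         ∃[ m ] (P m × (∀ {x} → x ∈ xs → P x → m ≲ x → x ≲ m))
  sink P (x ∷ xs) {a} a∈ Pa with em {∃[ y ] (y ∈ xs × P y)}
  -- Only the first entry satisfies `P`, so `a` and `y` coincide and the given relation is already
  -- the required one.
  ... | no none = a , Pa , λ y∈ Py a≲y →
        let a≡y = ≡.trans (only a∈ Pa) (≡.sym (only y∈ Py)) in
        subst (_≲ a) a≡y (subst (a ≲_) (≡.sym a≡y) a≲y)
    where
    only : ∀ {y} → y ∈ x ∷ xs → P y → y ≡ x
    only (here y≡x)  _  = y≡x
    only (there y∈) Py = ⊥-elim (none (_ , y∈ , Py))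
  ... | yes (y , y∈ , Py) with sink P xs y∈ Py
  ...   | m , Pm , min with em {P x × m ≲ x × ¬ x ≲ m}
  ...     | yes (Px , m≲x , _) = x , Px , λ
            { (here refl) _ → id
            ; (there z∈) Pz x≲z → ≲-trans (min z∈ Pz (≲-trans m≲x x≲z)) m≲x }
  ...     | no ¬better = m , Pm , λ
            { (here refl) Px m≲x → decidable-stable em λ x≴m → ¬better (Px , m≲x , x≴m)
            ; (there z∈) → min z∈ }

module _ {Sg : Signature} where
  open Signature Sg
  open Language Sg
  open import Data.List.Membership.DecPropositional _≟_ using (_∈?_)

  infix 4 _∈ₐ_
  _∈ₐ_ : ∀ {n} → Pr → Atom n → Set
  q ∈ₐ a = q ∈ atomPred a

  -- Second-order formulas do not depend on the interpretation of predicate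
  -- symbols once a valuation is given, so the two sides may use different ones.
  module _ {D : Set} {fn : (f : Fn) → Vec D (arᶠ f) → D} {d e : D}
           {r s : (q : Pr) → Vec D (arᵖ q) → Bool} where
    private
      I J : Interpretation
      I = record { Dom = D ; inhabited = d ; fnᴵ = fn ; relᴵ = r }
      J = record { Dom = D ; inhabited = e ; fnᴵ = fn ; relᴵ = s }
      module I = Semantics I
      module J = Semantics J

    mutual
      eval-≡ : ∀ {n} (σ : Vec D n) t → I.eval σ t ≡ J.eval σ t
      eval-≡ σ (var i)    = refl
      eval-≡ σ (fun f ts) = cong (fn f) (evals-≡ σ ts)

      evals-≡ : ∀ {n k} (σ : Vec D n) (ts : Vec (Term n) k) → I.evals σ ts ≡ J.evals σ ts
      evals-≡ σ []       = refl
      evals-≡ σ (t ∷ ts) = cong₂ _∷_ (eval-≡ σ t) (evals-≡ σ ts)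

    update-cong : ∀ {ρ ρ′ : I.Valuation} → (∀ x → ρ x ≗ ρ′ x) → ∀ x R y →
                  (ρ I.[ x ↦ R ]) y ≗ (ρ′ J.[ x ↦ R ]) y
    update-cong eq x R y v with x ≟ᴾ y
    ... | yes refl = refl
    ... | no _     = eq y v

    Sat-cong : ∀ {n} {ρ ρ′ : I.Valuation} → (∀ x → ρ x ≗ ρ′ x) → (σ : Vec D n) (F : SOFormula n) →
               I.Sat ρ σ F ⇔ J.Sat ρ′ σ F
    Sat-cong {ρ = ρ} eq σ (rel x ts) = T-cong (≡.trans (cong (ρ x) (evals-≡ σ ts)) (eq x _))
    Sat-cong eq σ (t ≐ u)  = mk⇔ (λ p → ≡.trans (≡.sym (eval-≡ σ t)) (≡.trans p (eval-≡ σ u)))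
                                 (λ p → ≡.trans (eval-≡ σ t) (≡.trans p (≡.sym (eval-≡ σ u))))
    Sat-cong eq σ ⊥′       = ⇔-id _
    Sat-cong eq σ (F ∧ G)  = Sat-cong eq σ F ×-⇔ Sat-cong eq σ G
    Sat-cong eq σ (F ∨ G)  = Sat-cong eq σ F ⊎-⇔ Sat-cong eq σ G
    Sat-cong eq σ (F ⇒ G)  = →-cong-⇔ (Sat-cong eq σ F) (Sat-cong eq σ G)
    Sat-cong eq σ (∀′ F)   = ∀-⇔ λ c → Sat-cong eq (c ∷ σ) F
    Sat-cong eq σ (∃′ F)   = ∃-⇔ λ c → Sat-cong eq (c ∷ σ) F
    Sat-cong eq σ (∃ᵖ x F) = ∃-⇔ λ R → Sat-cong (update-cong eq x R) σ F

  -- Occurrences of names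

  private
    ++⁺ : {as bs as′ bs′ : List Pr} {q : Pr} → (q ∈ as → q ∈ as′) → (q ∈ bs → q ∈ bs′) → q ∈ as ++ bs → q ∈ as′ ++ bs′
    ++⁺ {as} f g q∈ = [ ∈-++⁺ˡ ∘ f , ∈-++⁺ʳ _ ∘ g ]′ (∈-++⁻ as q∈)

  freePreds⊆allPreds : ∀ {n} (F : SOFormula n) {q} → q ∈ freePreds F → q ∈ allPreds F
  freePreds⊆allPreds (rel (sym _) _)   q∈ = q∈
  freePreds⊆allPreds (F ∧ G)           q∈ = ++⁺ (freePreds⊆allPreds F) (freePreds⊆allPreds G) q∈
  freePreds⊆allPreds (F ∨ G)           q∈ = ++⁺ (freePreds⊆allPreds F) (freePreds⊆allPreds G) q∈
  freePreds⊆allPreds (F ⇒ G)           q∈ = ++⁺ (freePreds⊆allPreds F) (freePreds⊆allPreds G) q∈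
  freePreds⊆allPreds (∀′ F)            q∈ = freePreds⊆allPreds F q∈
  freePreds⊆allPreds (∃′ F)            q∈ = freePreds⊆allPreds F q∈
  freePreds⊆allPreds (∃ᵖ (sym _) F)    q∈ = freePreds⊆allPreds F (proj₁ (∈-filter⁻ _ {xs = freePreds F} q∈))
  freePreds⊆allPreds (∃ᵖ (fresh _) F)  q∈ = freePreds⊆allPreds F q∈

  private
    occurs-++ : ∀ {A : Set} {xs ys : List A} (as bs : List Pr) {q} →
                (q ∈ as → ∃[ v ] v ∈ xs) → (q ∈ bs → ∃[ v ] v ∈ ys) → q ∈ as ++ bs → ∃[ v ] v ∈ xs ++ ys
    occurs-++ {xs = xs} as bs f g q∈ with ∈-++⁻ as q∈
    ... | inj₁ q∈as = let (v , v∈) = f q∈as in v , ∈-++⁺ˡ v∈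
    ... | inj₂ q∈bs = let (v , v∈) = g q∈bs in v , ∈-++⁺ʳ xs v∈

  -- Conditions on `binders` hold vacuously for a symbol without entries; this provides an entry to
  -- which they can be applied.
  binders-nonempty : ∀ {n} q b π (F : SOFormula n) → q ∈ allPreds F → ∃[ v ] v ∈ binders q b π F
  binders-nonempty q b π (rel (sym r) _) (here q≡r) rewrite dec-true (q ≟ r) q≡r = b , here refl
  binders-nonempty q b π (F ∧ G) = occurs-++ (allPreds F) (allPreds G) (binders-nonempty q b _ F) (binders-nonempty q b _ G)
  binders-nonempty q b π (F ∨ G) = occurs-++ (allPreds F) (allPreds G) (binders-nonempty q b _ F) (binders-nonempty q b _ G)
  binders-nonempty q b π (F ⇒ G) = occurs-++ (allPreds F) (allPreds G) (binders-nonempty q b _ F) (binders-nonempty q b _ G)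
  binders-nonempty q b π (∀′ F)   = binders-nonempty q b _ F
  binders-nonempty q b π (∃′ F)   = binders-nonempty q b _ F
  binders-nonempty q b π (∃ᵖ x F) = binders-nonempty q _ _ F

  -- Positions grow to the left, so κ ++ π ranges over the positions below π.
  Binder : Maybe Position → Position → List Pr → Pr → Maybe Position → Set
  Binder b π fs q v = (v ≡ b × q ∈ fs) ⊎ (∃[ κ ] v ≡ just (κ ++ π))

  binder-weaken : ∀ {b π fs gs q v} i → (q ∈ fs → q ∈ gs) → Binder b (i ∷ π) fs q v → Binder b π gs q v
  binder-weaken i f (inj₁ (v≡b , q∈))      = inj₁ (v≡b , f q∈)
  binder-weaken {π = π} i f (inj₂ (κ , eq)) = inj₂ (_ , ≡.trans eq (cong just (≡.sym (∷ʳ-++ κ i π))))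

  -- Only a quantifier over `q` replaces the inherited binder `b`, by its own position, and the same
  -- quantifier removes `q` from the free predicates.
  ∈-binders : ∀ {n} q b π (F : SOFormula n) {v} → v ∈ binders q b π F → Binder b π (freePreds F) q v
  private
    ∈-binders₂ : ∀ {n} q b π (F G : SOFormula n) {v} → v ∈ binders q b (0 ∷ π) F ++ binders q b (1 ∷ π) G →
                 Binder b π (freePreds F ++ freePreds G) q v
  ∈-binders q b π (rel (sym r) _) v∈ with q ≟ r
  ∈-binders q b π (rel (sym r) _) (here v≡b) | yes q≡r = inj₁ (v≡b , here q≡r)
  ∈-binders q b π (F ∧ G) = ∈-binders₂ q b π F G
  ∈-binders q b π (F ∨ G) = ∈-binders₂ q b π F G
  ∈-binders q b π (F ⇒ G) = ∈-binders₂ q b π F G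
  ∈-binders q b π (∀′ F)  v∈ = binder-weaken 0 id (∈-binders q b _ F v∈)
  ∈-binders q b π (∃′ F)  v∈ = binder-weaken 0 id (∈-binders q b _ F v∈)
  ∈-binders q b π (∃ᵖ (fresh r) F) v∈ = binder-weaken 0 id (∈-binders q b _ F v∈)
  ∈-binders q b π (∃ᵖ (sym r) F) v∈ with q ≟ r
  ... | no q≢r = binder-weaken 0 (λ q∈ → ∈-filter⁺ _ q∈ (q≢r ∘ ≡.sym)) (∈-binders q b _ F v∈)
  ... | yes _ with ∈-binders q (just π) _ F v∈
  ...   | inj₁ (v≡π , _) = inj₂ ([] , v≡π)
  -- The second alternative of `Binder` does not mention the list of free predicates, so the empty
  -- list will do.
  ...   | inj₂ inner     = binder-weaken {fs = []} 0 (λ ()) (inj₂ inner)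
  ∈-binders₂ q b π F G v∈ with ∈-++⁻ (binders q b (0 ∷ π) F) v∈
  ... | inj₁ v∈F = binder-weaken 0 ∈-++⁺ˡ (∈-binders q b _ F v∈F)
  ... | inj₂ v∈G = binder-weaken 1 (∈-++⁺ʳ (freePreds F)) (∈-binders q b _ G v∈G)

  -- A binder inherited from the context must not be mistaken for a quantifier at `π` or below it.
  Outside : Maybe Position → Position → Set
  Outside b π = ∀ κ → b ≢ just (κ ++ π)

  outside-child : ∀ {b π} i → Outside b π → Outside b (i ∷ π)
  outside-child {π = π} i out κ eq = out _ (≡.trans eq (cong just (≡.sym (∷ʳ-++ κ i π))))

  -- A list is never a proper suffix of itself: cancelling `π` would make the nonempty list
  -- `κ ++ i ∷ []` empty.
  parent-outside : ∀ {π} i → Outside (just π) (i ∷ π)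
  parent-outside {π} i κ eq with κ | ++-identityˡ-unique {xs = π} (κ ++ i ∷ []) (≡.trans (just-injective eq) (≡.sym (∷ʳ-++ κ i π)))
  ... | []    | ()
  ... | _ ∷ _ | ()

  -- An occurrence in either of two disjoint subformulas that has the same
  -- binder as one in the other cannot be bound inside its subformula.
  shared-free : ∀ {n} q b π (F G : SOFormula n) → Outside b π →
                (∃[ v ] All (_≡ v) (binders q b (0 ∷ π) F ++ binders q b (1 ∷ π) G)) →
                q ∈ allPreds F → q ∈ allPreds G → q ∈ freePreds F × q ∈ freePreds G
  shared-free q b π F G out (v , all) q∈F q∈G
    with binders-nonempty q b (0 ∷ π) F q∈F | binders-nonempty q b (1 ∷ π) G q∈G
  ... | vF , vF∈ | vG , vG∈
    with ∈-binders q b _ F vF∈ | ∈-binders q b _ G vG∈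
       | ≡.trans (All.lookup all (∈-++⁺ˡ vF∈)) (≡.sym (All.lookup all (∈-++⁺ʳ (binders q b (0 ∷ π) F) vG∈)))
  ... | inj₁ (_ , q∈)  | inj₁ (_ , q∈′) | _    = q∈ , q∈′
  ... | inj₁ (refl , _) | inj₂ (κ , eq)  | refl = ⊥-elim (outside-child 1 out κ eq)
  ... | inj₂ (κ , eq)  | inj₁ (refl , _) | refl = ⊥-elim (outside-child 0 out κ eq)
  -- Both binders lie inside their conjuncts. After `π` is cancelled, one position ends in 0 and the
  -- other in 1.
  ... | inj₂ (κ , eq)  | inj₂ (κ′ , eq′) | refl
    with ∷ʳ-injectiveʳ κ κ′ (++-cancelʳ π _ _ (≡.trans (∷ʳ-++ κ 0 π)
           (≡.trans (just-injective (≡.trans (≡.sym eq) eq′)) (≡.sym (∷ʳ-++ κ′ 1 π)))))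
  ...   | ()

  -- Predicates of differences, conjunctions and stable model formulas.

  ∈-∖⁺ : ∀ {S q} qs → q ∈ qs → S q ≡ false → q ∈ qs ∖ S
  ∈-∖⁺ qs q∈ Sq = ∈-deduplicate⁺ _≟_ (∈-filter⁺ _ q∈ Sq)

  ∈-∖⁻ : ∀ {S q} qs → q ∈ qs ∖ S → q ∈ qs × S q ≡ false
  ∈-∖⁻ {S} qs q∈ = ∈-filter⁻ _ {xs = qs} (∈-deduplicate⁻ _≟_ _ q∈)

  ∈-pred-⋀⁻ : ∀ {n q} (Fs : List (Formula n)) → q ∈ pred (⋀ Fs) → ∃[ F ] (F ∈ Fs × q ∈ pred F)
  ∈-pred-⋀⁻ (F ∷ [])     q∈ = F , here refl , q∈
  ∈-pred-⋀⁻ (F ∷ G ∷ Fs) q∈ =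
    [ (λ q∈F → F , here refl , q∈F)
    , (λ q∈G → let (H , H∈ , q∈H) = ∈-pred-⋀⁻ (G ∷ Fs) q∈G in H , there H∈ , q∈H)
    ]′ (∈-++⁻ (pred F) q∈)

  freePreds-⌈⌉ : ∀ {n q} (F : Formula n) → q ∈ pred F → q ∈ freePreds ⌈ F ⌉
  freePreds-⌈⌉ F q∈ = subst (_ ∈_) (≡.sym (go F)) q∈
    where
    go : ∀ {n} (F : Formula n) → freePreds ⌈ F ⌉ ≡ pred F
    go (atom (rel _ _)) = refl
    go (atom (_ ≐ _))   = refl
    go ⊥′               = refl
    go (F ∧ G)          = cong₂ _++_ (go F) (go G)
    go (F ∨ G)          = cong₂ _++_ (go F) (go G)
    go (F ⇒ G)          = cong₂ _++_ (go F) (go G)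
    go (∀′ F)           = go F
    go (∃′ F)           = go F

  freePreds-∀*² : ∀ {n} (F : SOFormula n) → freePreds (∀*² F) ≡ freePreds F
  freePreds-∀*² {zero}  F = refl
  freePreds-∀*² {suc n} F = freePreds-∀*² (∀′ F)

  freePreds-⋀² : ∀ {n q F} {Fs : List (SOFormula n)} → F ∈ Fs → q ∈ freePreds F → q ∈ freePreds (⋀² Fs)
  freePreds-⋀² {Fs = _ ∷ []}     (here refl) q∈ = q∈
  freePreds-⋀² {Fs = _ ∷ _ ∷ _}  (here refl) q∈ = ∈-++⁺ˡ q∈
  freePreds-⋀² {Fs = F ∷ _ ∷ _}  (there F∈)  q∈ = ∈-++⁺ʳ (freePreds F) (freePreds-⋀² F∈ q∈)

  freePreds-∃ᵖ*-fresh : ∀ {n} qs (F : SOFormula n) → freePreds (∃ᵖ* (map fresh qs) F) ≡ freePreds F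
  freePreds-∃ᵖ*-fresh []       F = refl
  freePreds-∃ᵖ*-fresh (_ ∷ qs) F = freePreds-∃ᵖ*-fresh qs F

  freePreds-∃ᵖ*-sym : ∀ {n q} qs (F : SOFormula n) → q ∈ freePreds (∃ᵖ* (map sym qs) F) → q ∈ freePreds F × q ∉ qs
  freePreds-∃ᵖ*-sym []       F q∈ = q∈ , λ ()
  freePreds-∃ᵖ*-sym (r ∷ qs) F q∈ with ∈-filter⁻ _ {xs = freePreds (∃ᵖ* (map sym qs) F)} q∈
  ... | q∈′ , r≢q with freePreds-∃ᵖ*-sym qs F q∈′
  ...   | q∈F , q∉qs = q∈F , λ { (here q≡r) → r≢q (≡.sym q≡r) ; (there q∈qs) → q∉qs q∈qs }

  -- A symbol of `p` that is absent from `F` still occurs in `U< p`, and the prefix binds only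
  -- `fresh` names.
  freePreds-SM : ∀ {q} p F → q ∈ p ⊎ q ∈ pred F → q ∈ freePreds (SM p F)
  freePreds-SM p F (inj₂ q∈F) = ∈-++⁺ˡ (freePreds-⌈⌉ F q∈F)
  freePreds-SM {q} p F (inj₁ q∈p) = ∈-++⁺ʳ (freePreds ⌈ F ⌉) (∈-++⁺ˡ
    (subst (q ∈_) (≡.sym (freePreds-∃ᵖ*-fresh p (U< p ∧ star p F))) (∈-++⁺ˡ (∈-++⁺ˡ
      (freePreds-⋀² (∈-map⁺ fresh⇒sym q∈p) (subst (q ∈_) (≡.sym (freePreds-∀*² {arᵖ q} _)) (here refl)))))))

  -- The shape of the formula of a modular program.

  -- Forgets how programs are nested and keeps the tree of conjunctions and hiding quantifiers over
  -- its def-modules. Prenexing can then go by induction on this tree.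
  data Assembles : SOFormula 0 → List DefModule → Set where
    leaf  : ∀ d → Assembles (SM (intensional d) (formula d)) (d ∷ [])
    empty : Assembles (⋀² []) []
    _∧_   : ∀ {F G ds es} → Assembles F ds → Assembles G es → Assembles (F ∧ G) (ds ++ es)
    bind  : ∀ {F ds} q → Assembles F ds → Assembles (∃ᵖ (sym q) F) ds

  assembles-∃ᵖ* : ∀ {F ds} qs → Assembles F ds → Assembles (∃ᵖ* (map sym qs) F) ds
  assembles-∃ᵖ* []       A = A
  assembles-∃ᵖ* (q ∷ qs) A = bind q (assembles-∃ᵖ* qs A)

  mutual
    assembles-Φ : ∀ Π → Assembles (Φ Π) (defmods Π)
    assembles-Φ ⟨ S , Ms ⟩ = assembles-∃ᵖ* (freePreds (⋀² (Φs Ms)) ∖ S) (assembles-Φs Ms)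

    assembles-Φs : ∀ Ms → Assembles (⋀² (Φs Ms)) (defmodsList Ms)
    assembles-Φs []                              = empty
    assembles-Φs (defModule d ∷ [])              = leaf d
    assembles-Φs (defModule d ∷ Ms@(_ ∷ _))      = leaf d ∧ assembles-Φs Ms
    assembles-Φs (subProgram Π ∷ [])             = subst (Assembles (Φ Π)) (≡.sym (++-identityʳ (defmods Π))) (assembles-Φ Π)
    assembles-Φs (subProgram Π ∷ Ms@(_ ∷ _))     = assembles-Φ Π ∧ assembles-Φs Ms

  allPreds-assembled : ∀ {F ds d q} → Assembles F ds → d ∈ ds → q ∈ intensional d ⊎ q ∈ pred (formula d) → q ∈ allPreds F
  allPreds-assembled (leaf d) (here refl) q∈ = freePreds⊆allPreds (SM (intensional d) (formula d)) (freePreds-SM _ (formula d) q∈)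
  allPreds-assembled (_∧_ {F} {ds = ds} A B) d∈ q∈ =
    [ (λ d∈ds → ∈-++⁺ˡ (allPreds-assembled A d∈ds q∈))
    , (λ d∈es → ∈-++⁺ʳ (allPreds F) (allPreds-assembled B d∈es q∈))
    ]′ (∈-++⁻ ds d∈)
  allPreds-assembled (bind _ A) d∈ q∈ = allPreds-assembled A d∈ q∈

  freePreds-Φ : ∀ Π {q} → q ∈ freePreds (Φ Π) → public′ Π q ≡ true
  freePreds-Φ ⟨ S , Ms ⟩ {q} q∈ with freePreds-∃ᵖ*-sym (freePreds (⋀² (Φs Ms)) ∖ S) (⋀² (Φs Ms)) q∈ | S q in Sq
  ... | _   , _   | true  = refl
  ... | q∈′ , q∉h | false = ⊥-elim (q∉h (∈-∖⁺ _ q∈′ Sq))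

  -- Intensional predicates and the dependency graph.

  ∈-int⁺ : ∀ {Π d q} → d ∈ defmods Π → q ∈ intensional d → q ∈ int Π
  ∈-int⁺ d∈ q∈ = ∈-concat⁺′ q∈ (∈-map⁺ intensional d∈)

  ∈-int⁻ : ∀ Π {q} → q ∈ int Π → ∃[ d ] (d ∈ defmods Π × q ∈ intensional d)
  ∈-int⁻ Π q∈ with ∈-concat⁻′ (map intensional (defmods Π)) q∈
  ... | _ , q∈p , p∈ with ∈-map⁻ intensional p∈
  ...   | d , d∈ , refl = d , d∈ , q∈p

  ∈-concat-atomPred : ∀ {n q a} {as : List (Atom n)} → q ∈ₐ a → a ∈ as → q ∈ concatMap atomPred as
  ∈-concat-atomPred q∈ a∈ = ∈-concat⁺′ q∈ (∈-map⁺ atomPred a∈)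

  path-target : ∀ {Π p q} → p ∈ int Π → Path Π p q → q ∈ int Π
  path-target p∈ ε        = p∈
  path-target p∈ (e ◅ es) = path-target (Edge.target∈ e) es

  -- Maximality: a strongly connected set including this one contains `m`, because of the empty
  -- path, so each of its vertices reaches `m` and is reached from it.
  mutual-reachability-SCC : ∀ {Π m} → m ∈ int Π → SCC Π (λ q → Path Π m q × Path Π q m)
  mutual-reachability-SCC {m = m} m∈ = record
    { stronglyConnected = record
      { nonempty  = m , ε , ε
      ; vertices  = path-target m∈ ∘ proj₁
      ; connected = λ (_ , p→m) (m→q , _) → p→m ◅◅ m→q }
    ; maximal = λ D sc C⊆D Dq → StronglyConnected.connected sc (C⊆D (ε , ε)) Dq
                              , StronglyConnected.connected sc Dq (C⊆D (ε , ε)) }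

  -- Here-and-there and stability over a fixed interpretation.

  module _ (I : Interpretation) where
    open Interpretation I using (Dom)
    open Semantics I

    PrVal : Set
    PrVal = (q : Pr) → Relation (arᵖ q)

    infix 4 _⊑_
    _⊑_ : PrVal → PrVal → Set
    W ⊑ M = ∀ q v → T (W q v) → T (M q v)

    override : {P : Pred Pr 0ℓ} → Decidable P → PrVal → PrVal → PrVal
    override P? A B q = if does (P? q) then A q else B q

    override-yes : ∀ {P : Pred Pr 0ℓ} (P? : Decidable P) A B {q} → P q → override P? A B q ≡ A q
    override-yes P? A B {q} Pq rewrite dec-true (P? q) Pq = refl

    override-no : ∀ {P : Pred Pr 0ℓ} (P? : Decidable P) A B {q} → ¬ P q → override P? A B q ≡ B q
    override-no P? A B {q} ¬Pq rewrite dec-false (P? q) ¬Pq = refl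

    -- The logic of here-and-there: for W ⊑ M the formula F* says about U, p
    -- what HT says about W, M, where W is U on p and agrees with M elsewhere.
    -- HT M M is classical satisfaction.
    HT : ∀ {n} → PrVal → PrVal → Vec Dom n → Formula n → Set
    HT W M σ (atom (rel q ts)) = T (W q (evals σ ts))
    HT W M σ (atom (t ≐ u))    = eval σ t ≡ eval σ u
    HT W M σ ⊥′                = ⊥
    HT W M σ (F ∧ G)           = HT W M σ F × HT W M σ G
    HT W M σ (F ∨ G)           = HT W M σ F ⊎ HT W M σ G
    HT W M σ (F ⇒ G)           = (HT W M σ F → HT W M σ G) × (HT M M σ F → HT M M σ G)
    HT W M σ (∀′ F)            = ∀ d → HT W M (d ∷ σ) F
    HT W M σ (∃′ F)            = ∃[ d ] HT W M (d ∷ σ) F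

    -- Implication is the only connective that could fail to be monotone, and its clause in `HT`
    -- carries truth at `M` as a second component.
    persistent : ∀ {n W M} {σ : Vec Dom n} → W ⊑ M → (F : Formula n) → HT W M σ F → HT M M σ F
    persistent W⊑M (atom (rel q _)) h        = W⊑M q _ h
    persistent W⊑M (atom (_ ≐ _))   h        = h
    persistent W⊑M (F ∧ G)          (h , k)  = persistent W⊑M F h , persistent W⊑M G k
    persistent W⊑M (F ∨ G)          (inj₁ h) = inj₁ (persistent W⊑M F h)
    persistent W⊑M (F ∨ G)          (inj₂ k) = inj₂ (persistent W⊑M G k)
    persistent W⊑M (F ⇒ G)          (_ , k)  = k , k
    persistent W⊑M (∀′ F)           h        = λ d → persistent W⊑M F (h d)
    persistent W⊑M (∃′ F)           (d , h)  = d , persistent W⊑M F h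

    HT-cong : ∀ {n W W′ M M′} (σ : Vec Dom n) (F : Formula n) →
              (∀ q → q ∈ pred F → W q ≗ W′ q) → (∀ q → q ∈ pred F → M q ≗ M′ q) →
              HT W M σ F ⇔ HT W′ M′ σ F
    HT-cong σ (atom (rel q ts)) w m = T-cong (w q (here refl) _)
    HT-cong σ (atom (_ ≐ _))    w m = ⇔-id _
    HT-cong σ ⊥′                w m = ⇔-id _
    HT-cong σ (F ∧ G)           w m = HT-cong σ F (λ q → w q ∘ ∈-++⁺ˡ) (λ q → m q ∘ ∈-++⁺ˡ)
                                  ×-⇔ HT-cong σ G (λ q → w q ∘ ∈-++⁺ʳ _) (λ q → m q ∘ ∈-++⁺ʳ _)
    HT-cong σ (F ∨ G)           w m = HT-cong σ F (λ q → w q ∘ ∈-++⁺ˡ) (λ q → m q ∘ ∈-++⁺ˡ)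
                                  ⊎-⇔ HT-cong σ G (λ q → w q ∘ ∈-++⁺ʳ _) (λ q → m q ∘ ∈-++⁺ʳ _)
    HT-cong σ (F ⇒ G)           w m =
      →-cong-⇔ (HT-cong σ F (λ q → w q ∘ ∈-++⁺ˡ) (λ q → m q ∘ ∈-++⁺ˡ))
               (HT-cong σ G (λ q → w q ∘ ∈-++⁺ʳ _) (λ q → m q ∘ ∈-++⁺ʳ _))
      ×-⇔
      →-cong-⇔ (HT-cong σ F (λ q → m q ∘ ∈-++⁺ˡ) (λ q → m q ∘ ∈-++⁺ˡ))
               (HT-cong σ G (λ q → m q ∘ ∈-++⁺ʳ _) (λ q → m q ∘ ∈-++⁺ʳ _))
    HT-cong σ (∀′ F)            w m = ∀-⇔ λ d → HT-cong (d ∷ σ) F w m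
    HT-cong σ (∃′ F)            w m = ∃-⇔ λ d → HT-cong (d ∷ σ) F w m

    HT-⋀ : ∀ {n W M} {σ : Vec Dom n} Fs → HT W M σ (⋀ Fs) ⇔ All (HT W M σ) Fs
    HT-⋀ []           = mk⇔ (λ _ → []) (λ _ → id , id)
    HT-⋀ (F ∷ [])     = mk⇔ (_∷ []) All.head
    HT-⋀ (F ∷ G ∷ Fs) = mk⇔ (λ (h , hs) → h ∷ hs) All.uncons ⇔-∘ (⇔-id _ ×-⇔ HT-⋀ (G ∷ Fs))

    HT-⋁ : ∀ {n W M} {σ : Vec Dom n} Fs → HT W M σ (⋁ Fs) ⇔ Any (HT W M σ) Fs
    HT-⋁ []           = mk⇔ (λ ()) (λ ())
    HT-⋁ (F ∷ [])     = mk⇔ here (λ { (here h) → h })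
    HT-⋁ (F ∷ G ∷ Fs) = mk⇔ Any.fromSum Any.toSum ⇔-∘ (⇔-id _ ⊎-⇔ HT-⋁ (G ∷ Fs))

    HT-∀* : ∀ {n W M} (F : Formula n) → HT W M [] (∀* F) ⇔ (∀ σ → HT W M σ F)
    HT-∀* {zero}  F = mk⇔ (λ { h [] → h }) (λ h → h [])
    HT-∀* {suc n} F = mk⇔ (λ { h (d ∷ σ) → h σ d }) (λ h σ d → h (d ∷ σ)) ⇔-∘ HT-∀* (∀′ F)

    HT-atom : ∀ {n W W′ M} {σ : Vec Dom n} (a : Atom n) → (∀ q → q ∈ₐ a → ∀ v → T (W q v) → T (W′ q v)) →
              HT W M σ (atom a) → HT W′ M σ (atom a)
    HT-atom (rel q ts) f h = f q (here refl) _ h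
    HT-atom (_ ≐ _)    f h = h

    -- Minimality is put positively, as `M ⊑ W`. Outside `p` one inclusion is demanded, and `W ⊑ M`
    -- turns it into agreement.
    record Stable (p : List Pr) (F : Formula 0) (M : PrVal) : Set where
      field
        classical : HT M M [] F
        minimal   : ∀ W → W ⊑ M → (∀ q → q ∉ p → ∀ v → T (M q v) → T (W q v)) → HT W M [] F → M ⊑ W
    open Stable

    StableModule : PrVal → DefModule → Set
    StableModule M d = Stable (intensional d) (formula d) M

    Stable-resp-≈ˢ : ∀ {p p′ F M} → p ≈ˢ p′ → Stable p F M → Stable p′ F M
    Stable-resp-≈ˢ eq st .classical = classical st
    Stable-resp-≈ˢ eq st .minimal W W⊑M off = minimal st W W⊑M λ q q∉p → off q (q∉p ∘ from (eq q))

    Stable-cong : ∀ {p F M M′} → (∀ q → q ∈ p ⊎ q ∈ pred F → M q ≗ M′ q) → Stable p F M → Stable p F M′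
    Stable-cong {p} {F} {M} {M′} eq st .classical =
      to (HT-cong [] F (λ q → eq q ∘ inj₂) (λ q → eq q ∘ inj₂)) (classical st)
    Stable-cong {p} {F} {M} {M′} eq st .minimal W′ W′⊑M′ off ht q v M′qv with q ∈? p
    ... | no q∉p  = off q q∉p v M′qv
    ... | yes q∈p = subst (λ R → T (R v)) (W≡W′ q∈p)
                      (minimal st W W⊑M W-off (from (HT-cong [] F W≗W′ (λ r → eq r ∘ inj₂)) ht)
                        q v (from (T-cong (eq q (inj₁ q∈p) v)) M′qv))
      where
      -- `W′` itself need not lie below `M`: the two models may differ on predicates that are
      -- neither in `p` nor in `F`. There `W` follows `M`.
      W : PrVal
      W = override (_∈? p) W′ M

      W≡W′ : ∀ {r} → r ∈ p → W r ≡ W′ r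
      W≡W′ = override-yes (_∈? p) W′ M

      W≡M : ∀ {r} → r ∉ p → W r ≡ M r
      W≡M = override-no (_∈? p) W′ M

      W⊑M : W ⊑ M
      W⊑M r u Wru with r ∈? p
      ... | yes r∈p = from (T-cong (eq r (inj₁ r∈p) u)) (W′⊑M′ r u Wru)
      ... | no _    = Wru

      W-off : ∀ r → r ∉ p → ∀ u → T (M r u) → T (W r u)
      W-off r r∉p u = subst (λ R → T (R u)) (≡.sym (W≡M r∉p))

      W≗W′ : ∀ r → r ∈ pred F → W r ≗ W′ r
      W≗W′ r r∈F u with r ∈? p
      ... | yes _  = refl
      ... | no r∉p = ≡.trans (eq r (inj₂ r∈F) u) (T-injective (mk⇔ (off r r∉p u) (W′⊑M′ r u)))

    -- Second-order sentences as statements about valuations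

    symbols variables : Valuation → PrVal
    symbols   ρ q = ρ (sym q)
    variables ρ q = ρ (fresh q)

    ⟪_,_⟫ : PrVal → PrVal → Valuation
    ⟪ M , U ⟫ (sym q)   = M q
    ⟪ M , U ⟫ (fresh q) = U q

    Sat-resp-≗ : ∀ {n ρ ρ′} → (∀ x → ρ x ≗ ρ′ x) → (σ : Vec Dom n) (F : SOFormula n) → Sat ρ σ F → Sat ρ′ σ F
    Sat-resp-≗ eq σ F = to (Sat-cong eq σ F)

    update-other : ∀ ρ {x y} R → x ≢ y → (ρ [ x ↦ R ]) y ≡ ρ y
    update-other ρ {x} {y} R x≢y with x ≟ᴾ y
    ... | yes x≡y = ⊥-elim (x≢y x≡y)
    ... | no _    = refl

    ∃ᵖ*-elim : ∀ {n ρ} {σ : Vec Dom n} {F} xs → Sat ρ σ (∃ᵖ* xs F) →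
               ∃[ ρ′ ] ((∀ y → y ∉ xs → ρ′ y ≗ ρ y) × Sat ρ′ σ F)
    ∃ᵖ*-elim {ρ = ρ} []       s       = ρ , (λ _ _ _ → refl) , s
    ∃ᵖ*-elim {ρ = ρ} (x ∷ xs) (R , s) with ∃ᵖ*-elim xs s
    ... | ρ′ , off , s′ = ρ′ , (λ y y∉ v → ≡.trans (off y (y∉ ∘ there) v)
                                   (cong (λ S → S v) (update-other ρ R (λ x≡y → y∉ (here (≡.sym x≡y)))))) , s′

    -- Every quantifier takes its witness from the one valuation `ρ′`, so a name repeated in the
    -- prefix gets the same value each time.
    ∃ᵖ*-intro : ∀ {n ρ ρ′} {σ : Vec Dom n} {F} xs → (∀ y → y ∉ xs → ρ′ y ≗ ρ y) → Sat ρ′ σ F → Sat ρ σ (∃ᵖ* xs F)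
    ∃ᵖ*-intro {σ = σ} {F} [] off s = Sat-resp-≗ (λ y → off y (λ ())) σ F s
    ∃ᵖ*-intro {ρ = ρ} {ρ′} (x ∷ xs) off s = ρ′ x , ∃ᵖ*-intro xs off′ s
      where
      off′ : ∀ y → y ∉ xs → ρ′ y ≗ (ρ [ x ↦ ρ′ x ]) y
      off′ y y∉ v with x ≟ᴾ y
      ... | yes refl = refl
      ... | no x≢y   = off y (λ { (here y≡x) → x≢y (≡.sym y≡x) ; (there y∈) → y∉ y∈ }) v

    Sat-⋀² : ∀ {n ρ} {σ : Vec Dom n} Fs → Sat ρ σ (⋀² Fs) ⇔ All (Sat ρ σ) Fs
    Sat-⋀² []           = mk⇔ (λ _ → []) (λ _ → id)
    Sat-⋀² (F ∷ [])     = mk⇔ (_∷ []) All.head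
    Sat-⋀² (F ∷ G ∷ Fs) = mk⇔ (λ (h , hs) → h ∷ hs) All.uncons ⇔-∘ (⇔-id _ ×-⇔ Sat-⋀² (G ∷ Fs))

    Sat-∀*² : ∀ {n ρ} (F : SOFormula n) → Sat ρ [] (∀*² F) ⇔ (∀ σ → Sat ρ σ F)
    Sat-∀*² {zero}  F = mk⇔ (λ { h [] → h }) (λ h → h [])
    Sat-∀*² {suc n} F = mk⇔ (λ { h (d ∷ σ) → h σ d }) (λ h σ d → h (d ∷ σ)) ⇔-∘ Sat-∀*² (∀′ F)

    evals-variables : ∀ {n} (σ : Vec Dom n) → evals σ (tabulate var) ≡ σ
    evals-variables σ = ≡.trans (go id) (tabulate∘lookup σ)
      where
      go : ∀ {k} (f : Fin k → Fin _) → evals σ (tabulate (var ∘ f)) ≡ tabulate (lookup σ ∘ f)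
      go {zero}  f = refl
      go {suc k} f = cong (lookup σ (f zero) ∷_) (go (f ∘ suc))


    Sat-fresh⇒sym : ∀ {ρ} q → Sat ρ [] (fresh⇒sym q) ⇔ (∀ v → T (ρ (fresh q) v) → T (ρ (sym q) v))
    Sat-fresh⇒sym {ρ} q =
      ∀-⇔ (λ σ → →-cong-⇔ (T-cong (cong (ρ (fresh q)) (evals-variables σ))) (T-cong (cong (ρ (sym q)) (evals-variables σ))))
      ⇔-∘ Sat-∀*² {arᵖ q} _

    Sat-sym⇒fresh : ∀ {ρ} q → Sat ρ [] (sym⇒fresh q) ⇔ (∀ v → T (ρ (sym q) v) → T (ρ (fresh q) v))
    Sat-sym⇒fresh {ρ} q =
      ∀-⇔ (λ σ → →-cong-⇔ (T-cong (cong (ρ (sym q)) (evals-variables σ))) (T-cong (cong (ρ (fresh q)) (evals-variables σ))))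
      ⇔-∘ Sat-∀*² {arᵖ q} _

    Sat-⋀²-map : ∀ {ρ} {g : Pr → SOFormula 0} {P : Pr → Set} → (∀ q → Sat ρ [] (g q) ⇔ P q) →
                 ∀ p → Sat ρ [] (⋀² (map g p)) ⇔ (∀ q → q ∈ p → P q)
    Sat-⋀²-map {ρ} {g} eq p =
      mk⇔ (λ hs q q∈ → to (eq q) (All.lookup (All.map⁻ hs) q∈)) (λ f → All.map⁺ (All.tabulate λ {q} q∈ → from (eq q) (f q q∈)))
      ⇔-∘ Sat-⋀² (map g p)

    Sat-⌈⌉ : ∀ {n ρ} (σ : Vec Dom n) F → Sat ρ σ ⌈ F ⌉ ⇔ HT (symbols ρ) (symbols ρ) σ F
    Sat-⌈⌉ σ (atom (rel _ _)) = ⇔-id _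
    Sat-⌈⌉ σ (atom (_ ≐ _))   = ⇔-id _
    Sat-⌈⌉ σ ⊥′               = ⇔-id _
    Sat-⌈⌉ σ (F ∧ G)          = Sat-⌈⌉ σ F ×-⇔ Sat-⌈⌉ σ G
    Sat-⌈⌉ σ (F ∨ G)          = Sat-⌈⌉ σ F ⊎-⇔ Sat-⌈⌉ σ G
    Sat-⌈⌉ σ (F ⇒ G)          = mk⇔ (λ h → h , h) proj₁ ⇔-∘ →-cong-⇔ (Sat-⌈⌉ σ F) (Sat-⌈⌉ σ G)
    Sat-⌈⌉ σ (∀′ F)           = ∀-⇔ λ d → Sat-⌈⌉ (d ∷ σ) F
    Sat-⌈⌉ σ (∃′ F)           = ∃-⇔ λ d → Sat-⌈⌉ (d ∷ σ) F

    Sat-star : ∀ {n ρ} p (σ : Vec Dom n) F →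
               Sat ρ σ (star p F) ⇔ HT (override (_∈? p) (variables ρ) (symbols ρ)) (symbols ρ) σ F
    Sat-star p σ (atom (rel q ts)) with does (q ∈? p)
    ... | true  = ⇔-id _
    ... | false = ⇔-id _
    Sat-star p σ (atom (_ ≐ _)) = ⇔-id _
    Sat-star p σ ⊥′             = ⇔-id _
    Sat-star p σ (F ∧ G)        = Sat-star p σ F ×-⇔ Sat-star p σ G
    Sat-star p σ (F ∨ G)        = Sat-star p σ F ⊎-⇔ Sat-star p σ G
    Sat-star p σ (F ⇒ G)        = →-cong-⇔ (Sat-star p σ F) (Sat-star p σ G) ×-⇔ →-cong-⇔ (Sat-⌈⌉ σ F) (Sat-⌈⌉ σ G)
    Sat-star p σ (∀′ F)         = ∀-⇔ λ d → Sat-star p (d ∷ σ) F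
    Sat-star p σ (∃′ F)         = ∃-⇔ λ d → Sat-star p (d ∷ σ) F

    sym∉fresh : ∀ {q} p → sym q ∉ map fresh p
    sym∉fresh p q∈ with ∈-map⁻ fresh q∈
    ... | _ , _ , ()

    Sat-SM : ∀ {ρ} p F → Sat ρ [] (SM p F) ⇔ Stable p F (symbols ρ)
    Sat-SM {ρ} p F = mk⇔ forth back
      where
      forth : Sat ρ [] (SM p F) → Stable p F (symbols ρ)
      forth (cl , _)  .classical = to (Sat-⌈⌉ [] F) cl
      -- Relations are Boolean, so it suffices to refute that `W` misses a tuple of `M`. Such a `W`,
      -- read as values of the predicate variables, is what `none` excludes.
      forth (_ , none) .minimal W W⊑M off ht q v Mqv = decidable-stable (T? (W q v)) λ ¬Wqv →
        none (∃ᵖ*-intro {ρ′ = ρ′} (map fresh p) ρ′-off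
          ( ( from (Sat-⋀²-map Sat-fresh⇒sym p) (λ r r∈p v → W⊑M r v ∘ subst (λ R → T (R v)) (U≡W r∈p))
            , λ full → ¬Wqv (M⊑W (λ r r∈p u Mru → subst (λ R → T (R u)) (U≡W r∈p)
                (to (Sat-⋀²-map Sat-sym⇒fresh p) full r r∈p u Mru)) q v Mqv) )
          , from (Sat-star p [] F) (to (HT-cong [] F (λ r _ → W≗ r) (λ _ _ _ → refl)) ht) ))
        where
        -- Outside `p` the old values stay, since the prefix binds only the `fresh` names of `p`.
        U : PrVal
        U = override (_∈? p) W (variables ρ)

        ρ′ : Valuation
        ρ′ = ⟪ symbols ρ , U ⟫

        U≡W : ∀ {r} → r ∈ p → U r ≡ W r
        U≡W = override-yes (_∈? p) W (variables ρ)

        ρ′-off : ∀ y → y ∉ map fresh p → ρ′ y ≗ ρ y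
        ρ′-off (sym r)   _  u = refl
        ρ′-off (fresh r) y∉ u = cong (λ R → R u) (override-no (_∈? p) W (variables ρ) (y∉ ∘ ∈-map⁺ fresh))

        M⊑W : (∀ r → r ∈ p → ∀ u → T (ρ (sym r) u) → T (W r u)) → symbols ρ ⊑ W
        M⊑W on r u Mru with r ∈? p
        ... | yes r∈p = on r r∈p u Mru
        ... | no r∉p  = off r r∉p u Mru

        W≗ : ∀ r → W r ≗ override (_∈? p) U (symbols ρ) r
        W≗ r u with r ∈? p
        ... | yes r∈p = refl
        ... | no r∉p  = T-injective (mk⇔ (W⊑M r u) (off r r∉p u))

      back : Stable p F (symbols ρ) → Sat ρ [] (SM p F)
      back st = from (Sat-⌈⌉ [] F) (classical st) , smaller
        where
        smaller : ¬ Sat ρ [] (∃ᵖ* (map fresh p) (U< p ∧ star p F))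
        smaller s with ∃ᵖ*-elim (map fresh p) s
        ... | ρ′ , off , (U⊑M , proper) , ht = proper (from (Sat-⋀²-map Sat-sym⇒fresh p) λ q q∈p v Mqv →
                subst (λ R → T (R v)) (override-yes (_∈? p) (variables ρ′) (symbols ρ′) q∈p)
                  (minimal st′ W W⊑M W-off (to (Sat-star p [] F) ht) q v Mqv))
          where
          W : PrVal
          W = override (_∈? p) (variables ρ′) (symbols ρ′)

          st′ : Stable p F (symbols ρ′)
          st′ = Stable-cong (λ q _ v → ≡.sym (off (sym q) (sym∉fresh p) v)) st

          W⊑M : W ⊑ symbols ρ′
          W⊑M q v Wqv with q ∈? p
          ... | yes q∈p = to (Sat-⋀²-map Sat-fresh⇒sym p) U⊑M q q∈p v Wqv
          ... | no _    = Wqv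

          W-off : ∀ q → q ∉ p → ∀ v → T (ρ′ (sym q) v) → T (W q v)
          W-off q q∉p v = subst (λ R → T (R v)) (≡.sym (override-no (_∈? p) (variables ρ′) (symbols ρ′) q∉p))

    -- Splitting

    -- Each rule comes with `P`, which restricts its head, and with its membership in `F`, from
    -- which dependency edges are built.
    rulewise : ∀ {A B M P F} → (∀ r → P r → RuleIn r F → HT A M [] (ruleFormula r) → HT B M [] (ruleFormula r)) →
               ConjunctionOfRules P F → HT A M [] F → HT B M [] F
    rulewise f empty       _       = id , id
    rulewise f (rule r Pr) h       = f r Pr here h
    rulewise f (C ∧ D)     (h , k) = rulewise (λ r Pr r∈ → f r Pr (left r∈)) C h
                                   , rulewise (λ r Pr r∈ → f r Pr (right r∈)) D k

    literals : (r : Rule) → List (Formula (Rule.vars r))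
    literals r = map atom pos ++ map (λ a → ¬′ (atom a)) neg ++ map (λ a → ¬′ (¬′ (atom a))) nneg
      where open Rule r

    HT-rule : ∀ {W M} r → HT W M [] (ruleFormula r) ⇔
              (∀ σ → (All (HT W M σ) (literals r) → Any (HT W M σ ∘ atom) (Rule.head r))
                   × (All (HT M M σ) (literals r) → Any (HT M M σ ∘ atom) (Rule.head r)))
    HT-rule {W} {M} r = ∀-⇔ (λ σ → half W σ ×-⇔ half M σ) ⇔-∘ HT-∀* (⋀ (literals r) ⇒ ⋁ (map atom (Rule.head r)))
      where
      half : ∀ V σ → (HT V M σ (⋀ (literals r)) → HT V M σ (⋁ (map atom (Rule.head r)))) ⇔
                     (All (HT V M σ) (literals r) → Any (HT V M σ ∘ atom) (Rule.head r))
      half V σ = →-cong-⇔ (HT-⋀ (literals r)) (mk⇔ Any.map⁻ Any.map⁺ ⇔-∘ HT-⋁ (map atom (Rule.head r)))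

    module _ {W M : PrVal} (W⊑M : W ⊑ M) where

      -- A body true at `W` persists to `M`, where the rule yields a true head atom; its predicate
      -- has lost no tuple, so the atom is true at `W`.
      heads-true : ∀ r → (∀ q → q ∈ headPreds r → ∀ v → T (M q v) → T (W q v)) →
                   HT M M [] (ruleFormula r) → HT W M [] (ruleFormula r)
      heads-true r M⊑W h = from (HT-rule r) λ σ →
        let (classically , _) = to (HT-rule r) h σ in
        (λ body → let (a , a∈ , Ma) = find (classically (All.map (λ {F} → persistent W⊑M F) body)) in
                  lose a∈ (HT-atom a (λ q q∈a → M⊑W q (∈-concat-atomPred q∈a a∈)) Ma))
        , classically

      -- A negation is decided at `M`: if `M` refutes `F`, then by persistence so does everything
      -- below `M`.
      HT-¬ : ∀ {n V} {σ : Vec Dom n} → V ⊑ M → (F : Formula n) → HT V M σ (¬′ F) → HT W M σ (¬′ F)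
      HT-¬ V⊑M F (_ , ¬F) = ¬F ∘ persistent W⊑M F , ¬F

      module _ {C : Pred Pr 0ℓ} (C? : Decidable C) where
        private
          V : PrVal
          V = override C? W M

        override-⊑ : V ⊑ M
        override-⊑ q v Vqv with C? q
        ... | yes _ = W⊑M q v Vqv
        ... | no _  = Vqv

        ⊑-override : W ⊑ V
        ⊑-override q v Wqv with C? q
        ... | yes _ = Wqv
        ... | no _  = W⊑M q v Wqv

        atom-or-C : ∀ {n} {σ : Vec Dom n} a → HT M M σ (atom a) → HT V M σ (atom a) ⊎ ∃[ q ] (q ∈ₐ a × C q)
        atom-or-C (rel q ts) h with C? q
        ... | yes Cq = inj₂ (q , here refl , Cq)
        ... | no _   = inj₁ h
        atom-or-C (_ ≐ _)    h = inj₁ h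

        -- A body true at `V` gives a head atom true at `M`. If its predicate is outside `C`, then
        -- `V` agrees with `M` on it. Otherwise `deps` makes the body true at `W`, and the possibly
        -- different head atom obtained there passes up to `V`.
        override-rule : ∀ r →
          (∀ {q s} → q ∈ headPreds r → C q → s ∈ posPreds r → ¬ C s → ∀ v → T (M s v) → T (W s v)) →
          HT W M [] (ruleFormula r) → HT V M [] (ruleFormula r)
        override-rule r deps h = from (HT-rule r) λ σ →
          let (hereW , classically) = to (HT-rule r) h σ in
          (λ body → let (a , a∈ , Ma) = find (classically (All.map (λ {F} → persistent override-⊑ F) body)) in
             [ lose a∈
             , (λ (q , q∈a , Cq) → Any.map (λ {b} → HT-atom b λ s _ → ⊑-override s)
                                     (hereW (bodyW σ (deps (∈-concat-atomPred q∈a a∈) Cq) body)))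
             ]′ (atom-or-C a Ma))
          , classically
          where
          open Rule r

          positive : ∀ {s} → (¬ C s → ∀ v → T (M s v) → T (W s v)) → ∀ v → T (V s v) → T (W s v)
          positive {s} M⊑W v Vsv with C? s
          ... | yes _ = Vsv
          ... | no ¬C = M⊑W ¬C v Vsv

          bodyW : ∀ σ → (∀ {s} → s ∈ posPreds r → ¬ C s → ∀ v → T (M s v) → T (W s v)) →
                  All (HT V M σ) (literals r) → All (HT W M σ) (literals r)
          bodyW σ M⊑W body with All.++⁻ (map atom pos) body
          ... | hp , hn with All.++⁻ (map (λ a → ¬′ (atom a)) neg) hn
          ...   | h¬ , h¬¬ = All.++⁺
                  (All.map⁺ (All.tabulate λ {a} a∈ →
                    HT-atom a (λ s s∈a → positive (M⊑W (∈-concat-atomPred s∈a a∈))) (All.lookup (All.map⁻ hp) a∈)))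
                  (All.++⁺ (All.map⁺ (All.map (λ {a} → HT-¬ override-⊑ (atom a)) (All.map⁻ h¬)))
                           (All.map⁺ (All.map (λ {a} → HT-¬ override-⊑ (¬′ (atom a))) (All.map⁻ h¬¬))))

    module _ (em : ExcludedMiddle 0ℓ) (Π : ModularProgram) (coherent : Coherent Π) (M : PrVal) where
      open Coherent coherent

      program⇒modules : Stable (int Π) (𝓕 Π) M → ∀ {d} → d ∈ defmods Π → StableModule M d
      program⇒modules st {d} d∈ = λ where
          .classical → All.lookup formulas d∈
          .minimal W W⊑M off ht → minimal st W W⊑M (λ q q∉ → off q (q∉ ∘ ∈-int⁺ {Π} d∈))
            (from (HT-⋀ _) (All.map⁺ (All.tabulate λ e∈ → every W W⊑M off ht e∈)))
        where
        formulas : All (HT M M [] ∘ formula) (defmods Π)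
        formulas = All.map⁻ (to (HT-⋀ (map formula (defmods Π))) (classical st))

        every : ∀ W → W ⊑ M → (∀ q → q ∉ intensional d → ∀ v → T (M q v) → T (W q v)) → HT W M [] (formula d) →
                ∀ {e} → e ∈ defmods Π → HT W M [] (formula e)
        -- Def-modules are compared classically, as function symbols carry no equality test. A
        -- module other than `d` has heads disjoint from `intensional d`, where `W` changes nothing.
        every W W⊑M off ht {e} e∈ with em {d ≡ e}
        ... | yes refl = ht
        ... | no d≢e = rulewise
                (λ r heads _ → heads-true W⊑M r λ q q∈ → off q λ q∈d → disjoint d∈ e∈ d≢e (q∈d , heads q∈))
                (simple e∈) (All.lookup formulas e∈)

      modules⇒program : (∀ {d} → d ∈ defmods Π → StableModule M d) → Stable (int Π) (𝓕 Π) M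
      modules⇒program sts .classical = from (HT-⋀ _) (All.map⁺ (All.tabulate (classical ∘ sts)))
      modules⇒program sts .minimal W W⊑M off ht q v Mqv = decidable-stable (T? (W q v)) λ ¬Wqv →
          absurd (sink {_≲_ = Path Π} em _◅◅_ Lost (int Π) (lost∈ (v , Mqv , ¬Wqv)) (v , Mqv , ¬Wqv))
        where
        Lost : Pred Pr 0ℓ
        Lost r = ∃[ u ] (T (M r u) × ¬ T (W r u))

        lost∈ : ∀ {r} → Lost r → r ∈ int Π
        lost∈ {r} (u , Mru , ¬Wru) = decidable-stable (r ∈? int Π) λ r∉ → ¬Wru (off r r∉ u Mru)

        -- Keep W only on the component C of a lost predicate from which no other
        -- component with a lost predicate is reachable, and restore M elsewhere.
        absurd : ∃[ m ] (Lost m × (∀ {r} → r ∈ int Π → Lost r → Path Π m r → Path Π r m)) → ⊥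
        absurd (m , lost@(u , Mmu , ¬Wmu) , min) with components _ (mutual-reachability-SCC (lost∈ lost))
        ... | d , d∈ , C⊆d = ¬Wmu (subst (λ R → T (R u)) (override-yes C? W M (ε , ε))
            (minimal (sts d∈) V (override-⊑ W⊑M C?) V-off V-ht m u Mmu))
          where
          C : Pred Pr 0ℓ
          C r = Path Π m r × Path Π r m

          C? : Decidable C
          C? _ = em

          V : PrVal
          V = override C? W M

          V-off : ∀ r → r ∉ intensional d → ∀ w → T (M r w) → T (V r w)
          V-off r r∉ w = subst (λ R → T (R w)) (≡.sym (override-no C? W M (r∉ ∘ C⊆d)))

          -- If `s` had lost a tuple, the edge from `p` to `s` would make it reachable from `m`; by
          -- the choice of `m` it would reach `m` back and lie in `C`.
          kept : ∀ {r} → RuleIn r (formula d) → ∀ {p s} → p ∈ headPreds r → C p → s ∈ posPreds r → ¬ C s →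
                 ∀ w → T (M s w) → T (W s w)
          kept r∈ {p} {s} p∈ (m→p , p→m) s∈ ¬Cs w Msw = decidable-stable (T? (W s w)) λ ¬Wsw →
            let s∈int = lost∈ (w , Msw , ¬Wsw)
                edge  = record { source∈ = path-target (lost∈ lost) m→p ; target∈ = s∈int
                               ; d∈ = d∈ ; r∈ = r∈ ; p∈head = p∈ ; q∈body = s∈ }
                m→s   = m→p ◅◅ (edge ◅ ε)
            in ¬Cs (m→s , min s∈int (w , Msw , ¬Wsw) m→s)

          V-ht : HT V M [] (formula d)
          V-ht = rulewise (λ r _ r∈ → override-rule W⊑M C? r (kept r∈)) (simple d∈)
                   (All.lookup (All.map⁻ (to (HT-⋀ (map formula (defmods Π))) ht)) d∈)

    -- Prenexing

    -- Every quantifier over `r`, at whatever level, takes `M r` as its witness.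
    modules⇒Sat : ∀ {F ds M ρ} → Assembles F ds → (∀ {d} → d ∈ ds → StableModule M d) →
                  (∀ q → q ∈ freePreds F → M q ≗ ρ (sym q)) → Sat ρ [] F
    modules⇒Sat (leaf d) sts eq =
      from (Sat-SM _ (formula d)) (Stable-cong (λ q q∈ → eq q (freePreds-SM _ (formula d) q∈)) (sts (here refl)))
    modules⇒Sat empty sts eq = id
    modules⇒Sat (_∧_ {F} {ds = ds} A B) sts eq =
      modules⇒Sat A (sts ∘ ∈-++⁺ˡ) (λ q → eq q ∘ ∈-++⁺ˡ)
      , modules⇒Sat B (sts ∘ ∈-++⁺ʳ ds) (λ q → eq q ∘ ∈-++⁺ʳ (freePreds F))
    modules⇒Sat {M = M} {ρ} (bind {F} r A) sts eq = M r , modules⇒Sat A sts eq′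
      where
      eq′ : ∀ q → q ∈ freePreds F → M q ≗ (ρ [ sym r ↦ M r ]) (sym q)
      eq′ q q∈ v with r ≟ q
      ... | yes refl = refl
      ... | no r≢q   = eq q (∈-filter⁺ _ q∈ r≢q) v

    -- `π` locates `F` in the whole formula and `b` gives the binders inherited there, so that
    -- uniqueness of binders passes to subformulas. At a conjunction it makes the interpretations
    -- found for the two sides compatible.
    Sat⇒modules : ∀ {F ds ρ} (b : Pr → Maybe Position) π → (∀ q → Outside (b q) π) →
                  (∀ q → ∃[ v ] All (_≡ v) (binders q (b q) π F)) → Assembles F ds → Sat ρ [] F →
                  ∃[ M ] ((∀ q → q ∈ freePreds F → M q ≗ ρ (sym q)) × (∀ {d} → d ∈ ds → StableModule M d))
    Sat⇒modules {ρ = ρ} b π out unique (leaf d) s = symbols ρ , (λ _ _ _ → refl) , λ { (here refl) → to (Sat-SM _ (formula d)) s }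
    Sat⇒modules {ρ = ρ} b π out unique empty s = symbols ρ , (λ _ _ _ → refl) , λ ()
    Sat⇒modules {ρ = ρ} b π out unique (bind {F} r A) (R , s)
      with Sat⇒modules _ (0 ∷ π) out′ unique A s
      where
      out′ : ∀ q → Outside (if isSym q (sym r) then just π else b q) (0 ∷ π)
      out′ q with does (q ≟ r)
      ... | true  = parent-outside 0
      ... | false = outside-child 0 (out q)
    ... | M , eq , sts = M , eq′ , sts
      where
      eq′ : ∀ q → q ∈ freePreds (∃ᵖ (sym r) F) → M q ≗ ρ (sym q)
      eq′ q q∈ v with ∈-filter⁻ _ {xs = freePreds F} q∈
      ... | q∈F , r≢q = ≡.trans (eq q q∈F v) (cong (λ S → S v) (update-other ρ {sym r} R λ { refl → r≢q refl }))
    Sat⇒modules {ρ = ρ} b π out unique (_∧_ {F} {G} {ds} {es} A B) (s , t)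
      with Sat⇒modules b (0 ∷ π) (outside-child 0 ∘ out) (λ q → let (v , all) = unique q in v , All.++⁻ˡ _ all) A s
         | Sat⇒modules b (1 ∷ π) (outside-child 1 ∘ out) (λ q → let (v , all) = unique q in v , All.++⁻ʳ (binders q (b q) (0 ∷ π) F) all) B t
    ... | M , M-eq , M-st | N , N-eq , N-st = K , K-eq , K-st
      where
      -- A symbol occurring on both sides is free in both by `shared-free`, so there `M` and `N`
      -- both agree with `ρ`.
      K : PrVal
      K = override (_∈? allPreds F) M N

      K≗N : ∀ q → q ∈ allPreds G → K q ≗ N q
      K≗N q q∈G v with q ∈? allPreds F
      ... | no _    = refl
      ... | yes q∈F = let (q∈F′ , q∈G′) = shared-free q (b q) π F G (out q) (unique q) q∈F q∈G in
                      ≡.trans (M-eq q q∈F′ v) (≡.sym (N-eq q q∈G′ v))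

      K≗M : ∀ q → q ∈ allPreds F → K q ≗ M q
      K≗M q q∈F v = cong (λ R → R v) (override-yes (_∈? allPreds F) M N q∈F)

      K-eq : ∀ q → q ∈ freePreds F ++ freePreds G → K q ≗ ρ (sym q)
      K-eq q q∈ v with ∈-++⁻ (freePreds F) q∈
      ... | inj₁ q∈F = ≡.trans (K≗M q (freePreds⊆allPreds F q∈F) v) (M-eq q q∈F v)
      ... | inj₂ q∈G = ≡.trans (K≗N q (freePreds⊆allPreds G q∈G) v) (N-eq q q∈G v)

      K-st : ∀ {d} → d ∈ ds ++ es → StableModule K d
      K-st d∈ with ∈-++⁻ ds d∈
      ... | inj₁ d∈ds = Stable-cong (λ q q∈ v → ≡.sym (K≗M q (allPreds-assembled A d∈ds q∈) v)) (M-st d∈ds)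
      ... | inj₂ d∈es = Stable-cong (λ q q∈ v → ≡.sym (K≗N q (allPreds-assembled B d∈es q∈) v)) (N-st d∈es)

  -- Hidden predicates, models and answer sets.

  module _ (em : ExcludedMiddle 0ℓ) (Π : ModularProgram) (coherent : Coherent Π) (public-free : PublicFree Π) where

    private
      S : PrSet
      S = public′ Π

      h : List Pr
      h = hidden Π

    public∉hidden : ∀ {q} → S q ≡ true → q ∉ h
    public∉hidden Sq q∈h with ≡.trans (≡.sym Sq) (proj₂ (∈-∖⁻ (allPreds (Φ Π)) q∈h))
    ... | ()

    -- An occurring symbol that is not hidden is public, and `PublicFree` lets no quantifier bind
    -- any of its occurrences.
    hidden-or-free : ∀ {q} → q ∈ allPreds (Φ Π) → q ∉ h → q ∈ freePreds (Φ Π)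
    hidden-or-free {q} q∈ q∉h with S q in Sq
    ... | false = ⊥-elim (q∉h (∈-∖⁺ (allPreds (Φ Π)) q∈ Sq))
    ... | true with binders-nonempty q nothing [] (Φ Π) q∈
    ...   | v , v∈ with ∈-binders q nothing [] (Φ Π) v∈ | All.lookup (public-free q (subst T (≡.sym Sq) _)) v∈
    ...     | inj₁ (_ , q∈free) | _    = q∈free
    ...     | inj₂ (_ , refl)   | ()

    relevant : ∀ {q} → q ∈ int Π ⊎ q ∈ pred (𝓕 Π) → q ∈ allPreds (Φ Π)
    relevant (inj₁ q∈) = let (d , d∈ , q∈d) = ∈-int⁻ Π q∈ in allPreds-assembled (assembles-Φ Π) d∈ (inj₁ q∈d)
    relevant (inj₂ q∈) with ∈-pred-⋀⁻ (map formula (defmods Π)) q∈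
    ... | F , F∈ , q∈F with ∈-map⁻ formula F∈
    ...   | d , d∈ , refl = allPreds-assembled (assembles-Φ Π) d∈ (inj₂ q∈F)

    one-binder : ∀ q → ∃[ v ] All (_≡ v) (binders q nothing [] (Φ Π))
    one-binder q = [ nothing ,_ , (λ (π , all) → just π , all) ]′ (Coherent.alphaNormal coherent q)

    -- The common middle term of the first equivalence: a choice of values for the hidden predicates
    -- that makes the joined program stable.
    HiddenExtension : (I : Interpretation) → PrVal I → Set
    HiddenExtension I M = (∀ q → q ∉ h → M q ≗ Interpretation.relᴵ I q) × Stable I (int Π) (𝓕 Π) M

    model⇔extension : ∀ I → (I ⊨ Φ Π) ⇔ ∃ (HiddenExtension I)
    model⇔extension I = mk⇔ forth back
      where
      open Interpretation I using (relᴵ)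

      forth : I ⊨ Φ Π → ∃ (HiddenExtension I)
      forth s with Sat⇒modules I (λ _ → nothing) [] (λ _ _ ()) one-binder (assembles-Φ Π) s
      ... | M , eq , sts = K , K-off , Stable-cong I K-on (modules⇒program I em Π coherent M sts)
        where
        -- `M` is tied to `I` only on the free predicates of `Φ Π`. Resetting it to `I` off `h`
        -- affects no predicate relevant to stability.
        K : PrVal I
        K = override I (_∈? h) M relᴵ

        K-off : ∀ q → q ∉ h → K q ≗ relᴵ q
        K-off q q∉h v = cong (λ R → R v) (override-no I (_∈? h) M relᴵ q∉h)

        K-on : ∀ q → q ∈ int Π ⊎ q ∈ pred (𝓕 Π) → M q ≗ K q
        K-on q q∈ v with q ∈? h
        ... | yes _  = refl
        ... | no q∉h = eq q (hidden-or-free (relevant q∈) q∉h) v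

      back : ∃ (HiddenExtension I) → I ⊨ Φ Π
      back (M , off , st) = modules⇒Sat I (assembles-Φ Π) (program⇒modules I em Π coherent M st)
        λ q q∈ → off q (public∉hidden (freePreds-Φ Π q∈))

    extension⇔∃SM : ∀ I → ∃ (HiddenExtension I) ⇔ (I ⊨ ∃ᵖ* (map sym h) (SM (int Π) (𝓕 Π)))
    extension⇔∃SM I = mk⇔ forth back
      where
      open Semantics I

      forth : ∃ (HiddenExtension I) → I ⊨ ∃ᵖ* (map sym h) (SM (int Π) (𝓕 Π))
      forth (M , off , st) = ∃ᵖ*-intro I {ρ′ = ρ} (map sym h)
          (λ { (sym q) q∉ → off q (q∉ ∘ ∈-map⁺ sym) ; (fresh q) _ _ → refl }) (from (Sat-SM I _ (𝓕 Π)) st)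
        where
        ρ : Valuation
        ρ = ⟪_,_⟫ I M (variables I valuation)

      back : I ⊨ ∃ᵖ* (map sym h) (SM (int Π) (𝓕 Π)) → ∃ (HiddenExtension I)
      back s with ∃ᵖ*-elim I (map sym h) s
      ... | ρ , off , s′ = symbols I ρ , (λ q q∉ → off (sym q) (q∉ ∘ sym∈)) , to (Sat-SM I _ (𝓕 Π)) s′
        where
        sym∈ : ∀ {q} → sym q ∈ map sym h → q ∈ h
        sym∈ q∈ with ∈-map⁻ sym q∈
        ... | _ , q∈h , refl = q∈h

    module _ (int≈pred : int Π ≈ˢ pred (𝓕 Π)) (I : Herbrand) where

      -- All Herbrand interpretations share domain and function symbols, so stability of `J` can be
      -- judged over `⟦ I ⟧ᴴ` with the relations of `J`.
      answerSet⇔ : ∀ J → AnswerSetOfFormula (𝓕 Π) J ⇔ Stable ⟦ I ⟧ᴴ (int Π) (𝓕 Π) (relᴴ J)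
      answerSet⇔ J =
        mk⇔ (Stable-resp-≈ˢ ⟦ I ⟧ᴴ (⇔-sym ∘ int≈pred)) (Stable-resp-≈ˢ ⟦ I ⟧ᴴ int≈pred)
        ⇔-∘ (Sat-SM ⟦ I ⟧ᴴ (pred (𝓕 Π)) (𝓕 Π)
        ⇔-∘ Sat-cong (λ _ _ → refl) [] (SM (pred (𝓕 Π)) (𝓕 Π)))

      answerSet⇔restriction : AnswerSetOfProgram Π I ⇔ (∃[ J ] (AnswerSetOfFormula (𝓕 Π) J × (I ≈ᴴ (J ∣ S))))
      answerSet⇔restriction = mk⇔ forth back
        where
        restricts : I over S → ∀ M → (∀ q → q ∉ h → M q ≗ relᴴ I q) → ∀ q ts → relᴴ I q ts ≡ S q && M q ts
        restricts within M off q ts = visible (S q) refl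
          where
          visible : ∀ b → S q ≡ b → relᴴ I q ts ≡ b && M q ts
          visible true  Sq = ≡.sym (off q (public∉hidden Sq) ts)
          visible false Sq = T-injective (mk⇔ (subst T Sq ∘ within q ts) (λ ()))

        forth : AnswerSetOfProgram Π I → ∃[ J ] (AnswerSetOfFormula (𝓕 Π) J × (I ≈ᴴ (J ∣ S)))
        forth (within , s) = let (M , off , st) = to (model⇔extension ⟦ I ⟧ᴴ) s in
          record { inhabitedᴴ = inhabitedᴴ I ; relᴴ = M } , from (answerSet⇔ _) st , restricts within M off

        back : ∃[ J ] (AnswerSetOfFormula (𝓕 Π) J × (I ≈ᴴ (J ∣ S))) → AnswerSetOfProgram Π I
        back (J , answer , eq) =
            (λ q ts → proj₁ ∘ to Bool.T-∧ ∘ subst T (eq q ts))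
          , from (model⇔extension ⟦ I ⟧ᴴ)
              (K , K-off , Stable-cong ⟦ I ⟧ᴴ K-on (to (answerSet⇔ J) answer))
          where
          -- Hidden values come from `J`. A relevant predicate outside `h` is free in `Φ Π`, hence
          -- public, and there `I` and `J` agree.
          K : PrVal ⟦ I ⟧ᴴ
          K = override ⟦ I ⟧ᴴ (_∈? h) (relᴴ J) (relᴴ I)

          K-off : ∀ q → q ∉ h → K q ≗ relᴴ I q
          K-off q q∉h v = cong (λ R → R v) (override-no ⟦ I ⟧ᴴ (_∈? h) (relᴴ J) (relᴴ I) q∉h)

          K-on : ∀ q → q ∈ int Π ⊎ q ∈ pred (𝓕 Π) → relᴴ J q ≗ K q
          K-on q q∈ v with q ∈? h
          ... | yes _  = refl
          ... | no q∉h = ≡.sym (≡.trans (eq q v) (cong (_&& relᴴ J q v) (freePreds-Φ Π (hidden-or-free (relevant q∈) q∉h))))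

theorem1 :
  ExcludedMiddle 0ℓ →
  (Sg : Signature) → let open Language Sg in
  (Π : ModularProgram) → Coherent Π → PublicFree Π →
  let p = int Π
      h = hidden Π
  in
  ((I : Interpretation) → (I ⊨ Φ Π) ⇔ (I ⊨ ∃ᵖ* (map sym h) (SM p (𝓕 Π))))
  ×
  (p ≈ˢ pred (𝓕 Π) →
    (I : Herbrand) →
    AnswerSetOfProgram Π I ⇔ (∃[ J ] (AnswerSetOfFormula (𝓕 Π) J × (I ≈ᴴ (J ∣ public′ Π)))))
theorem1 em Sg Π coherent public-free =
    (λ I → extension⇔∃SM em Π coherent public-free I ⇔-∘ model⇔extension em Π coherent public-free I)
  , answerSet⇔restriction em Π coherent public-free
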